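{- Let $G$ be a locally finite, connected graph with at most countably many ends. Then for every finite set of vertices $A'$ of $G$ there is a finite set of vertices $A \supseteq A'$ such that every connected component of $G-A$ is boundary-linked.
   Context: A ray is a one-way infinite path. Two rays of $G$ are equivalent if there are infinitely many pairwise vertex-disjoint paths between them in $G$; an end of $G$ is an equivalence class of rays. For a set of vertices $B$, its boundary is the set of edges of $G$ with exactly one endvertex in $B$. A set of vertices $B$ (here, the vertex set of a component) is called boundary-linked if the subgraph consisting of the induced subgraph $G[B]$ together with the boundary edges of $B$ (and their endvertices) contains a collection of pairwise edge-disjoint, pairwise equivalent (in $G$) rays $R_1, R_2, \ldots$ such that each edge of the boundary of $B$ is the first edge of one of the rays $R_i$. -}

module Defs where

open import Data.Fin using (Fin; zero; suc; inject₁; fromℕ)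
open import Data.List using (List)
open import Data.List.Membership.Propositional using () renaming (_∈_ to _∈ₗ_; _∉_ to _∉ₗ_)
open import Data.Nat using (ℕ) renaming (suc to sucℕ)
open import Data.Product using (Σ-syntax; ∃-syntax; _×_)
open import Data.Sum using (_⊎_)
open import Function.Definitions using (Congruent; Injective)
open import Level using (0ℓ)
open import Relation.Binary.PropositionalEquality using (_≡_; _≢_)
open import Relation.Unary using (Pred; _∈_; _∉_; _⊆_; U; Satisfiable)

-- Undirected loopless graphs, parallel edges allowed; a simple graph is one in
-- which any two edges joining the same two vertices are equal.  The order of
-- the two ends of an edge carries no meaning: `Joins` below is symmetric in
-- its last two arguments.
record Graph : Set₁ where
  field
    V        : Set
    E        : Set
    end₁     : E → V
    end₂     : E → V
    loopless : ∀ e → end₁ e ≢ end₂ e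

module _ (G : Graph) where
  open Graph G

  Joins : E → V → V → Set
  Joins e u v = (end₁ e ≡ u × end₂ e ≡ v) ⊎ (end₁ e ≡ v × end₂ e ≡ u)

  Incident : V → E → Set
  Incident v e = end₁ e ≡ v ⊎ end₂ e ≡ v

  LocallyFinite : Set
  LocallyFinite = ∀ v → ∃[ es ] (∀ e → Incident v e → e ∈ₗ es)

  -- Finite paths; a single vertex is a path of length 0.
  record Path : Set where
    field
      length    : ℕ
      vertex    : Fin (sucℕ length) → V
      edge      : Fin length → E
      joins     : ∀ i → Joins (edge i) (vertex (inject₁ i)) (vertex (suc i))
      injective : Injective _≡_ _≡_ vertex

    first : V
    first = vertex zero

    last : V
    last = vertex (fromℕ length)

  record Ray : Set where
    field
      vertex    : ℕ → V
      edge      : ℕ → E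
      joins     : ∀ i → Joins (edge i) (vertex i) (vertex (sucℕ i))
      injective : Injective _≡_ _≡_ vertex

  open Path using (first; last)

  -- The induced subgraph on B is connected.
  ConnectedOn : Pred V 0ℓ → Set
  ConnectedOn B = ∀ u v → u ∈ B → v ∈ B →
    Σ[ P ∈ Path ] (first P ≡ u × last P ≡ v × (∀ i → Path.vertex P i ∈ B))

  Connected : Set
  Connected = ConnectedOn U

  VertexDisjoint : Path → Path → Set
  VertexDisjoint P Q = ∀ i j → Path.vertex P i ≢ Path.vertex Q j

  PathBetween : Ray → Ray → Path → Set
  PathBetween R S P =
    (∃[ m ] first P ≡ Ray.vertex R m) × (∃[ n ] last P ≡ Ray.vertex S n)

  -- Vertex-disjoint paths are distinct, so the sequence P really consists of
  -- infinitely many paths.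
  _~_ : Ray → Ray → Set
  R ~ S = Σ[ P ∈ (ℕ → Path) ]
    ((∀ i → PathBetween R S (P i)) × (∀ i j → i ≢ j → VertexDisjoint (P i) (P j)))

  -- Ends are the classes of _~_; a function on rays that is congruent and
  -- injective with respect to _~_ is an injection of the set of ends into ℕ.
  CountablyManyEnds : Set
  CountablyManyEnds =
    Σ[ f ∈ (Ray → ℕ) ] (Congruent _~_ _≡_ f × Injective _~_ _≡_ f)

  -- B is the vertex set of a component of G − A.
  record IsComponentOutside (A : List V) (B : Pred V 0ℓ) : Set₁ where
    field
      nonempty  : Satisfiable B
      avoids    : ∀ v → v ∈ B → v ∉ₗ A
      connected : ConnectedOn B
      maximal   : ∀ (C : Pred V 0ℓ) → (∀ v → v ∈ C → v ∉ₗ A) →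
                  ConnectedOn C → B ⊆ C → C ⊆ B

  Boundary : Pred V 0ℓ → Pred E 0ℓ
  Boundary B e = (end₁ e ∈ B × end₂ e ∉ B) ⊎ (end₁ e ∉ B × end₂ e ∈ B)

  Inside : Pred V 0ℓ → Pred E 0ℓ
  Inside B e = end₁ e ∈ B × end₂ e ∈ B

  EdgeDisjoint : Ray → Ray → Set
  EdgeDisjoint R S = ∀ m n → Ray.edge R m ≢ Ray.edge S n

  -- Every vertex of a ray is an end of one of its edges, so a ray lies in the
  -- subgraph formed by G[B] and the boundary edges as soon as its edges do.
  -- The collection of rays may be finite, hence the arbitrary index type I.
  BoundaryLinked : Pred V 0ℓ → Set₁
  BoundaryLinked B =
    Σ[ I ∈ Set ] Σ[ R ∈ (I → Ray) ]
      ( (∀ i n → Inside B (Ray.edge (R i) n) ⊎ Boundary B (Ray.edge (R i) n))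
      × (∀ i j → i ≢ j → EdgeDisjoint (R i) (R j))
      × (∀ i j → R i ~ R j)
      × (∀ e → e ∈ Boundary B → ∃[ i ] Ray.edge (R i) 0 ≡ e) )

{-# OPTIONS --safe #-}

-- Around the end of a ray S take a core: a connected set B containing a tail of
-- S, disjoint from a given finite set, whose finite boundary is smallest among
-- all subsets of B containing a tail of S.  By Menger's theorem the boundary
-- edges of B can be continued by edge-disjoint trails to every core inside B,
-- and iterating this along a sequence of cores with empty intersection gives
-- edge-disjoint rays that all belong to the end of S: B is boundary-linked.
--
-- Enumerate the ends and let U grow: if the next end does not lie in U, add a
-- core of it that is disjoint from U, from A′ and from the ends of the boundary
-- edges of U.  Were the complement of U infinite at every step, Kőnig's lemma
-- would give a ray whose end is never captured.  So the complement is finite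
-- after some step, and it serves as A: the components of its complement are
-- the cores chosen so far.
module Submission where

open import Defs
open import Axiom.ExcludedMiddle using (ExcludedMiddle)
open import Data.Bool using (Bool; true; false; _∧_; _∨_; _xor_; not; if_then_else_)
open import Data.Bool.Properties using (xor-comm; xor-same; ∧-identityʳ; ∧-zeroʳ; not-injective) renaming (_≟_ to _≟ᵇ_)
open import Data.Empty using (⊥; ⊥-elim)
open import Data.Fin as Fin using (Fin; inject₁; fromℕ)
open import Data.Fin.Induction using (<-weakInduction)
open import Data.Fin.Properties using (suc-injective)
open import Data.List using (List; []; _∷_; _++_; map; length; filter; deduplicate; concatMap; applyUpTo; tabulate)
open import Data.List.Membership.Propositional using (_∈_; _∉_; find)
open import Data.List.Membership.Propositional.Properties
  using (∈-filter⁺; ∈-filter⁻; ∈-map⁺; ∈-map⁻; ∈-++⁺ˡ; ∈-++⁺ʳ; ∈-++⁻; ∈-∃++;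
          ∈-deduplicate⁺; ∈-deduplicate⁻; ∈-applyUpTo⁺; ∈-tabulate⁺; ∈-concatMap⁺; ∈-concatMap⁻)
open import Data.List.Properties using (length-map; length-++)
open import Data.List.Relation.Binary.Permutation.Propositional using (_↭_; refl; prep; swap; trans; ↭-sym; ↭⇒↭ₛ)
open import Data.List.Relation.Binary.Permutation.Propositional.Properties using (shift; ∈-resp-↭; ↭-length)
import Data.List.Relation.Binary.Permutation.Setoid.Properties as Perm
open import Data.List.Relation.Binary.Subset.Propositional using (_⊆_)
open import Data.List.Relation.Unary.All using (All; []; _∷_)
import Data.List.Relation.Unary.All as All
open import Data.List.Relation.Unary.All.Properties using (All¬⇒¬Any)
open import Data.List.Relation.Unary.AllPairs using ([]; _∷_)
open import Data.List.Relation.Unary.Any as Any using (here; there)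
open import Data.List.Relation.Unary.Unique.Propositional using (Unique)
import Data.List.Relation.Unary.Unique.Propositional.Properties as Unique
import Data.List.Relation.Unary.Unique.DecPropositional.Properties as DecUnique
open import Data.Nat
open import Data.Nat.Induction using (<-rec)
open import Data.Nat.Properties hiding (suc-injective)
open import Data.Nat.Tactic.RingSolver using (solve-∀)
open import Algebra.Properties.CommutativeSemigroup +-commutativeSemigroup using (interchange; x∙yz≈y∙xz)
open import Data.Product using (Σ; Σ-syntax; ∃; ∃-syntax; _×_; _,_; proj₁; proj₂)
open import Data.Sum using (_⊎_; inj₁; inj₂; [_,_]′; map₁)
open import Function using (_∘_; id; case_of_)
open import Level using (0ℓ)
open import Relation.Binary.Definitions using (DecidableEquality; tri<; tri≈; tri>)
open import Relation.Binary.PropositionalEquality as ≡ using (_≡_; _≢_; refl; sym; cong; cong₂; subst; module ≡-Reasoning)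
open import Relation.Nullary using (Dec; yes; no; ¬_; does)
open import Relation.Nullary.Decidable using (dec-true; dec-false; decidable-stable)
open import Relation.Unary using (Pred)

-- The inside of a core is infinite, and so is the region to be reached, so the finite Menger
-- theorem does not apply as it stands. A set with infinitely many crossing edges satisfies the cut
-- condition trivially, but one finite network has to satisfy it for all sets at once. `Tokens`
-- finds such a network by raising the bound one unit at a time, at the cost of finitely many edges
-- each. Cores further in may have larger boundaries than the first one. The tokens then arrive on
-- only some of the boundary edges, and the minimality of each core among its own subsets
-- re-establishes the cut condition there. Edge-disjointness is kept by never offering a used edge
-- again. Vertices may be revisited, so loops are erased once, from each infinite trail as a whole.

-- Boolean identities and counting in lists.

𝟙 : Bool → ℕ
𝟙 true  = 1
𝟙 false = 0

𝟙-not : ∀ b → 𝟙 b + 𝟙 (not b) ≡ 1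
𝟙-not true  = refl
𝟙-not false = refl

∧-true : ∀ {a b} → a ∧ b ≡ true → a ≡ true × b ≡ true
∧-true {true} {true} _ = refl , refl

∧-true⁺ : ∀ {a b} → a ≡ true → b ≡ true → a ∧ b ≡ true
∧-true⁺ refl refl = refl

∨-true : ∀ {a b} → a ∨ b ≡ true → a ≡ true ⊎ b ≡ true
∨-true {true}  _ = inj₁ refl
∨-true {false} p = inj₂ p

∨-true⁺ˡ : ∀ {a b} → a ≡ true → a ∨ b ≡ true
∨-true⁺ˡ refl = refl

∨-true⁺ʳ : ∀ {a b} → b ≡ true → a ∨ b ≡ true
∨-true⁺ʳ {true}  _ = refl
∨-true⁺ʳ {false} p = p

true≢false : ∀ {b} {A : Set} → b ≡ true → b ≡ false → A
true≢false refl ()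

¬true : ∀ {b} → ¬ b ≡ true → b ≡ false
¬true {true}  ¬p = ⊥-elim (¬p refl)
¬true {false} _  = refl

-- The contribution of one edge to the submodularity of cuts: `a`, `c` tell whether its ends lie in
-- the first set, `b`, `d` in the second. Equality fails, by 2, exactly when the edge joins the two
-- set differences.
submodular-xor : ∀ a b c d →
  𝟙 ((a ∧ b) xor (c ∧ d)) + 𝟙 ((a ∨ b) xor (c ∨ d)) ≤ 𝟙 (a xor c) + 𝟙 (b xor d)
submodular-xor true  true  true  true  = z≤n
submodular-xor true  true  true  false = s≤s z≤n
submodular-xor true  true  false true  = s≤s z≤n
submodular-xor true  true  false false = ≤-refl
submodular-xor true  false true  true  = s≤s z≤n
submodular-xor true  false true  false = z≤n
submodular-xor true  false false true  = z≤n
submodular-xor true  false false false = s≤s z≤n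
submodular-xor false true  true  true  = s≤s z≤n
submodular-xor false true  true  false = z≤n
submodular-xor false true  false true  = z≤n
submodular-xor false true  false false = s≤s z≤n
submodular-xor false false true  true  = ≤-refl
submodular-xor false false true  false = s≤s z≤n
submodular-xor false false false true  = s≤s z≤n
submodular-xor false false false false = z≤n

modular-𝟙 : ∀ a b → 𝟙 (a ∧ b) + 𝟙 (a ∨ b) ≡ 𝟙 a + 𝟙 b
modular-𝟙 true  b     = +-comm (𝟙 b) 1
modular-𝟙 false b     = refl

module _ {A : Set} where

  total : (A → ℕ) → List A → ℕ
  total g []       = 0
  total g (x ∷ xs) = g x + total g xs

  total-↭ : ∀ g {xs ys} → xs ↭ ys → total g xs ≡ total g ys
  total-↭ g refl         = refl
  total-↭ g (prep x p)   = cong (g x +_) (total-↭ g p)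
  total-↭ g (swap x y p) =
    ≡.trans (cong (λ n → g x + (g y + n)) (total-↭ g p)) (x∙yz≈y∙xz (g x) (g y) _)
  total-↭ g (trans p q)  = ≡.trans (total-↭ g p) (total-↭ g q)

  total-+ : ∀ g h xs → total (λ x → g x + h x) xs ≡ total g xs + total h xs
  total-+ g h []       = refl
  total-+ g h (x ∷ xs) =
    ≡.trans (cong (g x + h x +_) (total-+ g h xs)) (interchange (g x) (h x) _ _)

  total-mono : ∀ {g h} xs → (∀ x → x ∈ xs → g x ≤ h x) → total g xs ≤ total h xs
  total-mono []       g≤h = z≤n
  total-mono (x ∷ xs) g≤h = +-mono-≤ (g≤h x (here refl)) (total-mono xs (λ y → g≤h y ∘ there))

  total-cong : ∀ {g h} xs → (∀ x → x ∈ xs → g x ≡ h x) → total g xs ≡ total h xs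
  total-cong []       g≡h = refl
  total-cong (x ∷ xs) g≡h = cong₂ _+_ (g≡h x (here refl)) (total-cong xs (λ y → g≡h y ∘ there))

  total-mono₂ : ∀ {g h g′ h′} xs → (∀ x → x ∈ xs → g x + h x ≤ g′ x + h′ x) →
                total g xs + total h xs ≤ total g′ xs + total h′ xs
  total-mono₂ {g} {h} {g′} {h′} xs le = begin
    total g xs + total h xs          ≡⟨ total-+ g h xs ⟨
    total (λ x → g x + h x) xs       ≤⟨ total-mono xs le ⟩
    total (λ x → g′ x + h′ x) xs     ≡⟨ total-+ g′ h′ xs ⟩
    total g′ xs + total h′ xs        ∎
    where open ≤-Reasoning

  count : (A → Bool) → List A → ℕ
  count p = total (𝟙 ∘ p)

  select : (A → Bool) → List A → List A
  select p = filter (λ x → p x ≟ᵇ true)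

  ∈-select⁺ : ∀ (p : A → Bool) {x xs} → x ∈ xs → p x ≡ true → x ∈ select p xs
  ∈-select⁺ p = ∈-filter⁺ (λ x → p x ≟ᵇ true)

  ∈-select⁻ : ∀ (p : A → Bool) {x} xs → x ∈ select p xs → x ∈ xs × p x ≡ true
  ∈-select⁻ p xs = ∈-filter⁻ (λ x → p x ≟ᵇ true) {xs = xs}

  select-! : ∀ p {xs} → Unique xs → Unique (select p xs)
  select-! p = Unique.filter⁺ (λ x → p x ≟ᵇ true)

  length-select : ∀ p xs → length (select p xs) ≡ count p xs
  length-select p []       = refl
  length-select p (x ∷ xs) with p x
  ... | true  = cong suc (length-select p xs)
  ... | false = length-select p xs

  count-not : ∀ p xs → count p xs + count (not ∘ p) xs ≡ length xs
  count-not p []       = refl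
  count-not p (x ∷ xs) = ≡.trans (interchange (𝟙 (p x)) _ _ _) (cong₂ _+_ (𝟙-not (p x)) (count-not p xs))

  count≤length : ∀ p xs → count p xs ≤ length xs
  count≤length p xs = ≤-trans (m≤m+n _ _) (≤-reflexive (count-not p xs))

  Unique⇒∉ : ∀ {x : A} {xs} → Unique (x ∷ xs) → x ∉ xs
  Unique⇒∉ (x≢ ∷ _) = All¬⇒¬Any x≢

  Unique-tail : ∀ {x : A} {xs} → Unique (x ∷ xs) → Unique xs
  Unique-tail (_ ∷ u) = u

  ∉⇒Unique : ∀ {x : A} {xs} → x ∉ xs → Unique xs → Unique (x ∷ xs)
  ∉⇒Unique x∉ u = All.tabulate (λ { y∈ refl → x∉ y∈ }) ∷ u

  extract : ∀ {x : A} {xs} → x ∈ xs → ∃[ ys ] xs ↭ x ∷ ys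
  extract {x} x∈ with ys , zs , refl ← ∈-∃++ x∈ = ys ++ zs , shift x ys zs

  Unique-resp-↭ : ∀ {xs ys : List A} → xs ↭ ys → Unique xs → Unique ys
  Unique-resp-↭ p = Perm.Unique-resp-↭ (≡.setoid A) (↭⇒↭ₛ p)

  ∈-tail : ∀ {x y : A} {xs} → y ∈ x ∷ xs → y ≢ x → y ∈ xs
  ∈-tail (here y≡x)  y≢x = ⊥-elim (y≢x y≡x)
  ∈-tail (there y∈) _   = y∈

  Unique-⊆-length : ∀ {xs ys : List A} → Unique xs → xs ⊆ ys → length xs ≤ length ys
  Unique-⊆-length {[]}     _ _ = z≤n
  Unique-⊆-length {x ∷ xs} u xs⊆ys with extract (xs⊆ys (here refl))
  ... | zs , ys↭ = ≤-trans
    (s≤s (Unique-⊆-length (Unique-tail u)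
      (λ {y} y∈ → ∈-tail (∈-resp-↭ ys↭ (xs⊆ys (there y∈))) (λ { refl → Unique⇒∉ u y∈ }))))
    (≤-reflexive (sym (↭-length ys↭)))

  count-⊆ : ∀ p {xs ys} → Unique xs → xs ⊆ ys → count p xs ≤ count p ys
  count-⊆ p {xs} {ys} u xs⊆ys = begin
    count p xs              ≡⟨ length-select p xs ⟨
    length (select p xs)    ≤⟨ Unique-⊆-length (select-! p u)
                                 (λ x∈ → let x∈xs , px = ∈-select⁻ p xs x∈ in ∈-select⁺ p (xs⊆ys x∈xs) px) ⟩
    length (select p ys)    ≡⟨ length-select p ys ⟩
    count p ys              ∎
    where open ≤-Reasoning

-- Classical decisions and least elements.

module Classical (em : ExcludedMiddle 0ℓ) where

  ⟦_⟧ : Set → Bool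
  ⟦ A ⟧ = does (em {A})

  ⟦⟧⁺ : ∀ {A} → A → ⟦ A ⟧ ≡ true
  ⟦⟧⁺ = dec-true em

  ⟦⟧⁻ : ∀ {A} → ⟦ A ⟧ ≡ true → A
  ⟦⟧⁻ {A} p with em {A}
  ... | yes a = a

  ⟦⟧-false : ∀ {A} → ¬ A → ⟦ A ⟧ ≡ false
  ⟦⟧-false = dec-false em

  by-contradiction : ∀ {A : Set} → ¬ ¬ A → A
  by-contradiction = decidable-stable em

  _≡?_ : {A : Set} → DecidableEquality A
  x ≡? y = em

  abstract
    least : (P : ℕ → Set) → ∃ P → ∃[ n ] (P n × (∀ m → P m → n ≤ m))
    least P (n , Pn) = <-rec (λ n → P n → ∃[ n ] (P n × (∀ m → P m → n ≤ m))) go n Pn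
      where
      go : ∀ n → (∀ {m} → m < n → P m → ∃[ n ] (P n × (∀ m → P m → n ≤ m))) →
           P n → ∃[ n ] (P n × (∀ m → P m → n ≤ m))
      go n rec Pn with em {∃[ m ] (m < n × P m)}
      ... | yes (m , m<n , Pm) = rec m<n Pm
      ... | no  none           = n , Pn , λ m Pm → ≮⇒≥ λ m<n → none (m , m<n , Pm)

  uniq : {A : Set} → List A → List A
  uniq = deduplicate _≡?_

  uniq-! : {A : Set} (xs : List A) → Unique (uniq xs)
  uniq-! = DecUnique.deduplicate-! _≡?_

  -- Each entry of `xs` spoils at most one index. This is applied both to the vertices of a ray and
  -- to a sequence of disjoint paths.
  eventually-avoids : {A : Set} (Occ : ℕ → A → Set) →
    (∀ {i j x} → Occ i x → Occ j x → i ≡ j) →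
    ∀ xs → ∃[ N ] (∀ n → N ≤ n → ∀ {x} → Occ n x → x ∉ xs)
  eventually-avoids Occ disjoint []       = 0 , λ _ _ _ ()
  eventually-avoids Occ disjoint (x ∷ xs)
    with eventually-avoids Occ disjoint xs | em {∃[ i ] Occ i x}
  ... | N , avoid | yes (i , occ) = suc i ⊔ N , λ where
    n n≥ occ′ (here refl) → <⇒≢ (≤-trans (m≤m⊔n (suc i) N) n≥) (disjoint occ occ′)
    n n≥ occ′ (there x∈)  → avoid n (≤-trans (m≤n⊔m (suc i) N) n≥) occ′ x∈
  ... | N , avoid | no none = N , λ where
    n n≥ occ′ (here refl) → none (n , occ′)
    n n≥ occ′ (there x∈)  → avoid n n≥ occ′ x∈

-- Edge cuts, walks and paths.

module Cuts (em : ExcludedMiddle 0ℓ) (G : Graph) where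
  open Graph G
  open Classical em

  Region : Set
  Region = V → Bool

  ⟨_⟩ : Region → V → Set
  ⟨ C ⟩ v = C v ≡ true

  infix 4 _⊑_
  _⊑_ : Region → Region → Set
  C ⊑ D = ∀ v → C v ≡ true → D v ≡ true

  infixr 7 _∩_
  infixr 6 _∪_
  _∩_ _∪_ : Region → Region → Region
  (C ∩ D) v = C v ∧ D v
  (C ∪ D) v = C v ∨ D v

  cross : Region → E → Bool
  cross C e = C (end₁ e) xor C (end₂ e)

  Covers : Region → List E → Set
  Covers C M = ∀ e → cross C e ≡ true → e ∈ M

  Within : Region → E → Set
  Within C e = C (end₁ e) ≡ true × C (end₂ e) ≡ true

  ends : List E → List V
  ends M = map end₁ M ++ map end₂ M

  ∈-ends : ∀ {v e M} → Incident G v e → e ∈ M → v ∈ ends M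
  ∈-ends         (inj₁ refl) e∈ = ∈-++⁺ˡ (∈-map⁺ end₁ e∈)
  ∈-ends {M = M} (inj₂ refl) e∈ = ∈-++⁺ʳ (map end₁ M) (∈-map⁺ end₂ e∈)

  joins-sym : ∀ {e u v} → Joins G e u v → Joins G e v u
  joins-sym (inj₁ p) = inj₂ p
  joins-sym (inj₂ p) = inj₁ p

  joins-incident : ∀ {e u v} → Joins G e u v → Incident G u e
  joins-incident (inj₁ (p , _)) = inj₁ p
  joins-incident (inj₂ (_ , p)) = inj₂ p

  incident-joins : ∀ {e u} → Incident G u e → ∃[ v ] Joins G e u v
  incident-joins {e} (inj₁ p) = end₂ e , inj₁ (p , refl)
  incident-joins {e} (inj₂ p) = end₁ e , inj₂ (refl , p)

  joins-irreflexive : ∀ {e u} → ¬ Joins G e u u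
  joins-irreflexive {e} (inj₁ (refl , q)) = loopless e (sym q)
  joins-irreflexive {e} (inj₂ (refl , q)) = loopless e (sym q)

  cross-joins : ∀ C {e u v} → Joins G e u v → cross C e ≡ C u xor C v
  cross-joins C (inj₁ (refl , refl)) = refl
  cross-joins C {e} (inj₂ (refl , refl)) = xor-comm (C (end₁ e)) (C (end₂ e))

  cross-true : ∀ C {e u v} → Joins G e u v → C u ≡ true → C v ≡ false → cross C e ≡ true
  cross-true C J Cu Cv = ≡.trans (cross-joins C J) (cong₂ _xor_ Cu Cv)

  cross-false : ∀ C {e u v} → Joins G e u v → C u ≡ C v → cross C e ≡ false
  cross-false C {v = v} J Cu = ≡.trans (cross-joins C J) (≡.trans (cong (_xor C v) Cu) (xor-same (C v)))

  uncrossed : ∀ C {e u v} → Joins G e u v → ¬ cross C e ≡ true → C u ≡ C v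
  uncrossed C {u = u} {v} J ¬cr with C u in Cu | C v in Cv
  ... | true  | true  = refl
  ... | true  | false = ⊥-elim (¬cr (cross-true C J Cu Cv))
  ... | false | true  = ⊥-elim (¬cr (cross-true C (joins-sym J) Cv Cu))
  ... | false | false = refl

  crossing-ends : ∀ C {e} → cross C e ≡ true →
                  ∃[ u ] ∃[ v ] (Joins G e u v × C u ≡ true × C v ≡ false)
  crossing-ends C {e} cr with C (end₁ e) in p | C (end₂ e) in q
  ... | true  | false = end₁ e , end₂ e , inj₁ (refl , refl) , p , q
  ... | false | true  = end₂ e , end₁ e , inj₂ (refl , refl) , q , p

  within-uncrossed : ∀ {C e} → Within C e → cross C e ≡ false
  within-uncrossed (p , q) = cong₂ _xor_ p q

  within-incident : ∀ C {e u} → Within C e → Incident G u e → C u ≡ true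
  within-incident C (p , q) (inj₁ refl) = p
  within-incident C (p , q) (inj₂ refl) = q

  within-⊑ : ∀ {C D} → C ⊑ D → ∀ {e} → Within C e → Within D e
  within-⊑ C⊑D (p , q) = C⊑D _ p , C⊑D _ q

  boundary⇒cross : ∀ C {e} → Boundary G ⟨ C ⟩ e → cross C e ≡ true
  boundary⇒cross C (inj₁ (p , q)) = cong₂ _xor_ p (¬true q)
  boundary⇒cross C (inj₂ (p , q)) = cong₂ _xor_ (¬true p) q

  cross⇒boundary : ∀ C {e} → cross C e ≡ true → Boundary G ⟨ C ⟩ e
  cross⇒boundary C {e} cr with C (end₁ e) | C (end₂ e)
  ... | true  | false = inj₁ (refl , λ ())
  ... | false | true  = inj₂ ((λ ()) , refl)

  data Walk (Q : V → Set) : V → V → Set where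
    stop : ∀ {v} → Q v → Walk Q v v
    step : ∀ {e u v w} → Q u → Joins G e u v → Walk Q v w → Walk Q u w

  snoc : ∀ {Q e u v w} → Walk Q u v → Joins G e v w → Q w → Walk Q u w
  snoc (stop Qv)        J Qw = step Qv J (stop Qw)
  snoc (step Qu J′ wlk) J Qw = step Qu J′ (snoc wlk J Qw)

  walk-++ : ∀ {Q u v w} → Walk Q u v → Walk Q v w → Walk Q u w
  walk-++ (stop _)        wlk′ = wlk′
  walk-++ (step Qu J wlk) wlk′ = step Qu J (walk-++ wlk wlk′)

  walk-first : ∀ {Q u v} → Walk Q u v → Q u
  walk-first (stop Qu)     = Qu
  walk-first (step Qu _ _) = Qu

  walk-reverse : ∀ {Q u v} → Walk Q u v → Walk Q v u
  walk-reverse (stop Qu)       = stop Qu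
  walk-reverse (step Qu J wlk) = snoc (walk-reverse wlk) (joins-sym J) Qu

  walk-last : ∀ {Q u v} → Walk Q u v → Q v
  walk-last = walk-first ∘ walk-reverse

  open Path using (first; last)

  infix 4 _∋_
  _∋_ : Path G → V → Set
  P ∋ v = ∃[ i ] Path.vertex P i ≡ v

  singleton : V → Path G
  singleton v = record
    { length = 0 ; vertex = λ _ → v ; edge = λ () ; joins = λ ()
    ; injective = λ { {Fin.zero} {Fin.zero} _ → refl } }

  cons : ∀ {e u} (P : Path G) → Joins G e u (first P) → ¬ P ∋ u → Path G
  cons {e} {u} P J u∉ = record
    { length    = suc (Path.length P)
    ; vertex    = vertex
    ; edge      = λ { Fin.zero → e ; (Fin.suc i) → Path.edge P i }
    ; joins     = λ { Fin.zero → J ; (Fin.suc i) → Path.joins P i }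
    ; injective = λ {i} {j} → injective i j
    }
    where
    vertex : Fin (suc (suc (Path.length P))) → V
    vertex Fin.zero    = u
    vertex (Fin.suc i) = Path.vertex P i

    injective : ∀ i j → vertex i ≡ vertex j → i ≡ j
    injective Fin.zero    Fin.zero    _  = refl
    injective Fin.zero    (Fin.suc j) eq = ⊥-elim (u∉ (j , sym eq))
    injective (Fin.suc i) Fin.zero    eq = ⊥-elim (u∉ (i , eq))
    injective (Fin.suc i) (Fin.suc j) eq = cong Fin.suc (Path.injective P eq)

  suffix : ∀ (P : Path G) i →
    Σ[ P′ ∈ Path G ] (first P′ ≡ Path.vertex P i × last P′ ≡ last P × (∀ {v} → P′ ∋ v → P ∋ v))
  suffix P Fin.zero = P , refl , refl , id
  suffix record { length = suc l ; vertex = vertex ; edge = edge ; joins = joins ; injective = injective } (Fin.suc i)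
    with P′ , p , q , sub ← suffix (record
           { length = l ; vertex = vertex ∘ Fin.suc ; edge = edge ∘ Fin.suc
           ; joins = λ j → joins (Fin.suc j) ; injective = suc-injective ∘ injective }) i
    = P′ , p , q , λ v∈ → let j , eq = sub v∈ in Fin.suc j , eq

  -- If `u` already lies on the path found for the rest of the walk, the part of that path from `u`
  -- onwards is enough; otherwise `u` is put in front.
  walk⇒path : ∀ {Q u v} → Walk Q u v →
    Σ[ P ∈ Path G ] (first P ≡ u × last P ≡ v × (∀ i → Q (Path.vertex P i)))
  walk⇒path {u = u} (stop Qu) = singleton u , refl , refl , λ _ → Qu
  walk⇒path {Q} {u} (step Qu J wlk) with walk⇒path wlk
  ... | P , refl , refl , QP with em {P ∋ u}
  ... | no u∉ = cons P J u∉ , refl , refl , λ { Fin.zero → Qu ; (Fin.suc i) → QP i }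
  ... | yes (i , eq) with P′ , p , q , sub ← suffix P i =
    P′ , ≡.trans p eq , q , λ j → let i′ , eq′ = sub (j , refl) in subst Q eq′ (QP i′)

  path-constant : ∀ (P : Path G) (C : Region) → (∀ i → ¬ cross C (Path.edge P i) ≡ true) →
                  ∀ i → C (first P) ≡ C (Path.vertex P i)
  path-constant P C ¬cr = <-weakInduction _ refl
    (λ i eq → ≡.trans eq (uncrossed C (Path.joins P i) (¬cr i)))

  vertices : Path G → List V
  vertices P = tabulate (Path.vertex P)

  ∈-vertices : ∀ P i → Path.vertex P i ∈ vertices P
  ∈-vertices P i = ∈-tabulate⁺ {f = Path.vertex P} i

  -- Rays, finite cuts and equivalence of rays.

  open Ray using (vertex; edge; joins)

  Eventually : Ray G → Region → Set
  Eventually R C = ∃[ N ] (∀ n → N ≤ n → C (vertex R n) ≡ true)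

  eventually-∧ : ∀ R C D → Eventually R C → Eventually R D → Eventually R (λ v → C v ∧ D v)
  eventually-∧ R C D (M , inC) (N , inD) = M ⊔ N , λ n n≥ →
    ∧-true⁺ (inC n (≤-trans (m≤m⊔n M N) n≥)) (inD n (≤-trans (m≤n⊔m M N) n≥))

  eventually-⊑ : ∀ R {C D} → C ⊑ D → Eventually R C → Eventually R D
  eventually-⊑ R C⊑D (N , inC) = N , λ n n≥ → C⊑D _ (inC n n≥)

  ray-avoids : ∀ (R : Ray G) X → ∃[ N ] (∀ n → N ≤ n → vertex R n ∉ X)
  ray-avoids R X with N , avoid ← eventually-avoids {A = V} (λ n v → vertex R n ≡ v)
                                    (λ p q → Ray.injective R (≡.trans p (sym q))) X
    = N , λ n n≥ → avoid n n≥ refl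

  eventually-outside : ∀ R X → Eventually R (λ v → not ⟦ v ∈ X ⟧)
  eventually-outside R X with N , avoid ← ray-avoids R X =
    N , λ n n≥ → cong not (⟦⟧-false (avoid n n≥))

  -- A ray meets the finitely many ends of `M` only finitely often; after that none of its edges
  -- crosses `C`.
  settles : ∀ R C {M} → Covers C M → Eventually R C ⊎ Eventually R (not ∘ C)
  settles R C {M} cov with ray-avoids R (ends M)
  ... | N , avoid = decide (C (vertex R N)) refl
    where
    same : ∀ k → C (vertex R N) ≡ C (vertex R (k + N))
    same zero    = refl
    same (suc k) = ≡.trans (same k) (uncrossed C (joins R (k + N))
      λ cr → avoid (k + N) (m≤n+m N k) (∈-ends (joins-incident (joins R (k + N))) (cov _ cr)))

    same′ : ∀ n → N ≤ n → C (vertex R N) ≡ C (vertex R n)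
    same′ n n≥ = ≡.trans (same (n ∸ N)) (cong (C ∘ vertex R) (m∸n+n≡m n≥))

    decide : ∀ b → C (vertex R N) ≡ b → Eventually R C ⊎ Eventually R (not ∘ C)
    decide true  eq = inj₁ (N , λ n n≥ → ≡.trans (sym (same′ n n≥)) eq)
    decide false eq = inj₂ (N , λ n n≥ → cong not (≡.trans (sym (same′ n n≥)) eq))

  -- Otherwise one of the disjoint paths joining the rays avoids the initial
  -- segments outside or inside C and all ends of the finitely many edges in M,
  -- so it cannot get from outside C into C.
  eventually-~ : ∀ {R S} → _~_ G R S → ∀ C {M} → Covers C M → Eventually S C → Eventually R C
  eventually-~ {R} {S} (P , between , disjoint) C {M} cov (N , inC) with settles R C cov
  ... | inj₁ ev = ev
  ... | inj₂ (N′ , outC) with eventually-avoids (λ i v → P i ∋ v)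
        (λ {i} {j} (p , eq) (q , eq′) → by-contradiction λ i≢j → disjoint i j i≢j p q (≡.trans eq (sym eq′)))
        (applyUpTo (vertex R) N′ ++ applyUpTo (vertex S) N ++ ends M)
  ... | i , avoid with between i
  ... | (m , first≡) , (n , last≡) = true≢false in-C out-C
    where
    avoids : ∀ {v} → P i ∋ v → v ∉ applyUpTo (vertex R) N′ ++ applyUpTo (vertex S) N ++ ends M
    avoids = avoid i ≤-refl

    out-C : C (vertex R m) ≡ false
    out-C = not-injective (outC m (≮⇒≥ λ m<N′ →
      avoids (Fin.zero , first≡) (∈-++⁺ˡ (∈-applyUpTo⁺ (vertex R) m<N′))))

    in-C : C (vertex R m) ≡ true
    in-C = begin
      C (vertex R m)     ≡⟨ cong C first≡ ⟨
      C (first (P i))    ≡⟨ path-constant (P i) C (λ j cr → avoids (inject₁ j , refl)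
                              (∈-++⁺ʳ (applyUpTo (vertex R) N′) (∈-++⁺ʳ (applyUpTo (vertex S) N)
                                (∈-ends (joins-incident (Path.joins (P i) j)) (cov _ cr))))) _ ⟩
      C (last (P i))     ≡⟨ cong C last≡ ⟩
      C (vertex S n)     ≡⟨ inC n (≮⇒≥ λ n<N → avoids (fromℕ _ , last≡)
                              (∈-++⁺ʳ (applyUpTo (vertex R) N′) (∈-++⁺ˡ (∈-applyUpTo⁺ (vertex S) n<N)))) ⟩
      true               ∎
      where open ≡-Reasoning

  -- The disjoint paths are chosen greedily, each in a connected region that misses all vertices
  -- used before.
  equivalent : ∀ R S →
    (∀ X → Σ[ C ∈ Region ] (ConnectedOn G ⟨ C ⟩ × (∀ {v} → C v ≡ true → v ∉ X) ×
                            (∃[ m ] C (vertex R m) ≡ true) × (∃[ n ] C (vertex S n) ≡ true))) →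
    _~_ G R S
  equivalent R S meet = (λ n → proj₁ (link (used n))) , between , disjoint
    where
    link : ∀ X → Σ[ P ∈ Path G ] (PathBetween G R S P × (∀ i → Path.vertex P i ∉ X))
    link X with C , conn , avoid , (m , inR) , (n , inS) ← meet X
           with P , p , q , inC ← conn _ _ inR inS
      = P , ((m , p) , (n , q)) , λ i → avoid (inC i)

    used : ℕ → List V
    used zero    = []
    used (suc n) = vertices (proj₁ (link (used n))) ++ used n

    used-mono : ∀ k {n v} → v ∈ used n → v ∈ used (k + n)
    used-mono zero    v∈ = v∈
    used-mono (suc k) {n} v∈ = ∈-++⁺ʳ (vertices (proj₁ (link (used (k + n))))) (used-mono k v∈)

    between : ∀ i → PathBetween G R S (proj₁ (link (used i)))
    between i = proj₁ (proj₂ (link (used i)))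

    later : ∀ {i j} → i < j → VertexDisjoint G (proj₁ (link (used j))) (proj₁ (link (used i)))
    later {i} {j} i<j p q eq = proj₂ (proj₂ (link (used j))) p
      (subst (_∈ used j) (sym eq) (subst (λ n → Path.vertex (proj₁ (link (used i))) q ∈ used n) (m∸n+n≡m i<j)
        (used-mono (j ∸ suc i) {suc i} (∈-++⁺ˡ (∈-vertices (proj₁ (link (used i))) q)))))

    disjoint : ∀ i j → i ≢ j → VertexDisjoint G (proj₁ (link (used i))) (proj₁ (link (used j)))
    disjoint i j i≢j p q eq with <-cmp i j
    ... | tri< i<j _ _ = later i<j q p (sym eq)
    ... | tri≈ _ i≡j _ = i≢j i≡j
    ... | tri> _ _ j<i = later j<i p q eq

-- Existence of cores, and loop erasure.

module Cores (em : ExcludedMiddle 0ℓ) (G : Graph) where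
  open Graph G
  open Classical em
  open Cuts em G
  open Ray using (vertex)

  -- Minimality is tested against lists `M` that cover a cut: surplus entries only weaken the
  -- inequality, and a set with infinite boundary has no such list.
  record Core (S : Ray G) : Set where
    field
      region    : Region
      border    : List E
      border-!  : Unique border
      crosses   : ∀ {e} → e ∈ border → cross region e ≡ true
      covers    : Covers region border
      tail      : Eventually S region
      connected : ConnectedOn G ⟨ region ⟩
      minimal   : ∀ C → C ⊑ region → Eventually S C → ∀ {M} → Covers C M → length border ≤ length M

  module _ (S : Ray G) where

    -- The minimiser `C` need not be connected. Keeping only what is reachable from the tail of `S`
    -- inside `C` creates no new crossing edges, since an edge leaving `K` also leaves `C`; so
    -- minimality survives.
    core-within : ∀ D {M} → Covers D M → Eventually S D → Σ[ K ∈ Core S ] Core.region K ⊑ D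
    core-within D {M₀} cov₀ ev₀ with least
      (λ n → Σ[ C ∈ Region ] (C ⊑ D × Eventually S C × Σ[ M ∈ List E ] (Covers C M × length M ≡ n)))
      (length M₀ , D , (λ _ → id) , ev₀ , M₀ , cov₀ , refl)
    ... | _ , (C , C⊑D , (N , inC) , M , cov , refl) , min = record
      { region    = K
      ; border    = border
      ; border-!  = select-! (cross K) (uniq-! M)
      ; crosses   = λ e∈ → proj₂ (∈-select⁻ (cross K) (uniq M) e∈)
      ; covers    = covers
      ; tail      = N , λ n n≥ → ⟦⟧⁺ (subst (Walk ⟨ C ⟩ s ∘ vertex S) (m∸n+n≡m n≥) (along (n ∸ N)))
      ; connected = λ u v Ku Kv → walk⇒path (walk-++ (walk-reverse (inside Ku)) (inside Kv))
      ; minimal   = λ C′ C′⊑K ev {M′} cov′ → ≤-trans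
          (Unique-⊆-length (select-! (cross K) (uniq-! M))
            (λ e∈ → ∈-deduplicate⁻ _≡?_ M (proj₁ (∈-select⁻ (cross K) (uniq M) e∈))))
          (min _ (C′ , (λ v → C⊑D v ∘ K⊑C v ∘ C′⊑K v) , ev , M′ , cov′ , refl))
      } , λ v → C⊑D v ∘ K⊑C v
      where
      s : V
      s = vertex S N

      K : Region
      K v = ⟦ Walk ⟨ C ⟩ s v ⟧

      border : List E
      border = select (cross K) (uniq M)

      K⊑C : K ⊑ C
      K⊑C v Kv = walk-last (⟦⟧⁻ Kv)

      along : ∀ k → Walk ⟨ C ⟩ s (vertex S (k + N))
      along zero    = stop (inC N ≤-refl)
      along (suc k) = snoc (along k) (Ray.joins S (k + N)) (inC _ (m≤n+m N (suc k)))

      covers : Covers K border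
      covers e cr with u , v , J , Ku , Kv ← crossing-ends K cr =
        ∈-select⁺ (cross K) (∈-deduplicate⁺ _≡?_ (cov e (cross-true C J (K⊑C u Ku)
          (¬true λ Cv → true≢false (⟦⟧⁺ (snoc (⟦⟧⁻ Ku) J Cv)) Kv)))) cr

      inside : ∀ {v} → K v ≡ true → Walk ⟨ K ⟩ s v
      inside Kv = lift (stop (inC N ≤-refl)) (⟦⟧⁻ Kv)
        where
        lift : ∀ {u v} → Walk ⟨ C ⟩ s u → Walk ⟨ C ⟩ u v → Walk ⟨ K ⟩ u v
        lift su (stop _)        = stop (⟦⟧⁺ su)
        lift su (step _ J wlk) = step (⟦⟧⁺ su) J (lift (snoc su J (walk-first wlk)) wlk)

  -- Cutting a walk down to the last visits of its vertices turns it into a ray.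
  module LoopErasure (x : ℕ → V) (ε : ℕ → E)
    (moves : ∀ t → x (suc t) ≡ x t ⊎ Joins G (ε t) (x t) (x (suc t)))
    (leaves : ∀ v → ∃[ N ] (∀ t → N ≤ t → x t ≢ v))
    where

    last-visit : ∀ t → ∃[ n ] (t ≤ n × x n ≡ x t × (∀ m → n < m → x m ≢ x t))
    last-visit t with least (λ n → ∀ m → n < m → x m ≢ x t)
                        (let N , away = leaves (x t) in N , λ m N<m → away m (<⇒≤ N<m))
    ... | n , away , min = n , t≤n , by-contradiction x≢ , away
      where
      t≤n : t ≤ n
      t≤n = ≮⇒≥ λ n<t → away t n<t refl

      -- Otherwise `pred n` would already bound all visits, against the choice of `n`.
      x≢ : ¬ x n ≢ x t
      x≢ xn≢ = <⇒≱ n′<n (min n′ λ m n′<m →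
        [ away m , (λ { refl → xn≢ }) ]′ (m≤n⇒m<n∨m≡n (≤-trans (≤-reflexive (sym n≡)) n′<m)))
        where
        t<n : t < n
        t<n = ≤∧≢⇒< t≤n λ { refl → xn≢ refl }

        n′ : ℕ
        n′ = pred n

        n≡ : suc n′ ≡ n
        n≡ = suc-pred n ⦃ >-nonZero (≤-<-trans z≤n t<n) ⦄

        n′<n : n′ < n
        n′<n = ≤-reflexive n≡

    exit : ℕ → ℕ
    exit t = proj₁ (last-visit t)

    time : ℕ → ℕ
    time zero    = exit 0
    time (suc j) = exit (suc (time j))

    time-step : ∀ j → time j < time (suc j)
    time-step j = proj₁ (proj₂ (last-visit (suc (time j))))

    time-mono : ∀ {i j} → i < j → time i < time j
    time-mono {i} {suc j} (s≤s i≤j) with m≤n⇒m<n∨m≡n i≤j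
    ... | inj₁ i<j  = <-trans (time-mono i<j) (time-step j)
    ... | inj₂ refl = time-step j

    n≤time : ∀ n → n ≤ time n
    n≤time zero    = z≤n
    n≤time (suc n) = ≤-<-trans (n≤time n) (time-step n)

    final : ∀ j m → time j < m → x m ≢ x (time j)
    final zero    m lt eq with eq′ , away ← proj₂ (proj₂ (last-visit 0)) = away m lt (≡.trans eq eq′)
    final (suc j) m lt eq with eq′ , away ← proj₂ (proj₂ (last-visit (suc (time j)))) = away m lt (≡.trans eq eq′)

    ray : Ray G
    ray = record
      { vertex    = x ∘ time
      ; edge      = ε ∘ time
      ; joins     = joins
      ; injective = λ {i} {j} → injective i j
      }
      where
      joins : ∀ j → Joins G (ε (time j)) (x (time j)) (x (time (suc j)))
      -- After a last visit the walk cannot stand still, so the step is along an edge.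
      joins j with moves (time j)
      ... | inj₁ eq = ⊥-elim (final j _ ≤-refl eq)
      ... | inj₂ J  = subst (Joins G (ε (time j)) (x (time j)))
                        (sym (proj₁ (proj₂ (proj₂ (last-visit (suc (time j))))))) J

      injective : ∀ i j → x (time i) ≡ x (time j) → i ≡ j
      injective i j eq with <-cmp i j
      ... | tri< i<j _ _ = ⊥-elim (final i _ (time-mono i<j) (sym eq))
      ... | tri≈ _ i≡j _ = i≡j
      ... | tri> _ _ j<i = ⊥-elim (final j _ (time-mono j<i) eq)

    time-zero : (∀ t → x (suc t) ≢ x 0) → time 0 ≡ 0
    time-zero fresh with time 0 | proj₁ (proj₂ (proj₂ (last-visit 0)))
    ... | zero  | _  = refl
    ... | suc n | eq = ⊥-elim (fresh n eq)

-- Finite balls and the distance from a root.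

module Distances (em : ExcludedMiddle 0ℓ) (G : Graph) (locally-finite : LocallyFinite G)
                 (connected : Connected G) (r : Graph.V G) where
  open Graph G
  open Classical em
  open Cuts em G

  incident : V → List E
  incident v = select (λ e → ⟦ Incident G v e ⟧) (proj₁ (locally-finite v))

  ∈-incident : ∀ {v e} → Incident G v e → e ∈ incident v
  ∈-incident {v} {e} inc = ∈-select⁺ (λ e → ⟦ Incident G v e ⟧) (proj₂ (locally-finite v) e inc) (⟦⟧⁺ inc)

  -- A new boundary edge has an end in `X`, and by local finiteness there are only finitely many
  -- such edges.
  covers-restrict : ∀ C X {M} → Covers C M → Covers (λ v → C v ∧ not ⟦ v ∈ X ⟧) (M ++ concatMap incident X)
  covers-restrict C X {M} cov e cr with u , v , J , Du , Dv ← crossing-ends _ cr = decide em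
    where
    decide : Dec (v ∈ X) → e ∈ M ++ concatMap incident X
    decide (yes v∈X) = ∈-++⁺ʳ M (∈-concatMap⁺ incident
      (Any.map (λ { refl → ∈-incident (joins-incident (joins-sym J)) }) v∈X))
    decide (no v∉X)  = ∈-++⁺ˡ (cov e (cross-true C J (proj₁ (∧-true Du)) (begin
      C v                         ≡⟨ ∧-identityʳ (C v) ⟨
      C v ∧ true                  ≡⟨ cong (λ b → C v ∧ not b) (⟦⟧-false v∉X) ⟨
      C v ∧ not ⟦ v ∈ X ⟧         ≡⟨ Dv ⟩
      false                       ∎)))
      where open ≡-Reasoning

  neighbours : V → List V
  neighbours v = ends (incident v)

  ball : ℕ → List V
  ball zero    = r ∷ []
  ball (suc n) = ball n ++ concatMap neighbours (ball n)

  ball-joins : ∀ n {e u v} → Joins G e u v → u ∈ ball n → v ∈ ball (suc n)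
  ball-joins n J u∈ = ∈-++⁺ʳ (ball n) (∈-concatMap⁺ neighbours
    (Any.map (λ { refl → ∈-ends (joins-incident (joins-sym J)) (∈-incident (joins-incident J)) }) u∈))

  ball-mono : ∀ {m n} → m ≤ n → ball m ⊆ ball n
  ball-mono {m} {n} m≤n {v} v∈ = subst (λ k → v ∈ ball k) (m∸n+n≡m m≤n) (grow (n ∸ m))
    where
    grow : ∀ k → v ∈ ball (k + m)
    grow zero    = v∈
    grow (suc k) = ∈-++⁺ˡ (grow k)

  exhausted : ∀ v → ∃[ n ] v ∈ ball n
  exhausted v with P , refl , refl , _ ← connected r v _ _ = <-weakInduction
    (λ i → ∃[ n ] Path.vertex P i ∈ ball n) (0 , here refl)
    (λ i (n , i∈) → suc n , ball-joins n (Path.joins P i) i∈) (fromℕ _)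

  dist : V → ℕ
  dist v = proj₁ (least (λ n → v ∈ ball n) (exhausted v))

  ∈-ball-dist : ∀ v → v ∈ ball (dist v)
  ∈-ball-dist v = proj₁ (proj₂ (least (λ n → v ∈ ball n) (exhausted v)))

  dist-≤ : ∀ {v n} → v ∈ ball n → dist v ≤ n
  dist-≤ {v} {n} = proj₂ (proj₂ (least (λ n → v ∈ ball n) (exhausted v))) n

  ∉-ball : ∀ {v n} → v ∉ ball n → n < dist v
  ∉-ball {v} v∉ = ≰⇒> λ d≤n → v∉ (ball-mono d≤n (∈-ball-dist v))

  dist-bound : ∀ X → ∃[ n ] (∀ {v} → v ∈ X → dist v < n)
  dist-bound []      = 0 , λ ()
  dist-bound (x ∷ X) with n , bound ← dist-bound X = suc (dist x) ⊔ n , λ where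
    (here refl) → m≤m⊔n _ n
    (there v∈)  → ≤-trans (bound v∈) (m≤n⊔m (suc (dist x)) n)

  ∈-neighbours : ∀ {u v} → v ∈ neighbours u → v ≡ u ⊎ ∃[ e ] Joins G e u v
  ∈-neighbours {u} {v} v∈ with ends⁻ (incident u) v∈
    where
    ends⁻ : ∀ M → v ∈ ends M → ∃[ e ] (e ∈ M × Incident G v e)
    ends⁻ M v∈ with ∈-++⁻ (map end₁ M) v∈
    ... | inj₁ v∈₁ with e , e∈ , eq ← ∈-map⁻ end₁ v∈₁ = e , e∈ , inj₁ (sym eq)
    ... | inj₂ v∈₂ with e , e∈ , eq ← ∈-map⁻ end₂ v∈₂ = e , e∈ , inj₂ (sym eq)
  ... | e , e∈ , v-inc
    with ⟦⟧⁻ (proj₂ (∈-select⁻ (λ e → ⟦ Incident G u e ⟧) (proj₁ (locally-finite u)) e∈)) | v-inc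
  ... | inj₁ p | inj₁ q = inj₁ (≡.trans (sym q) p)
  ... | inj₁ p | inj₂ q = inj₂ (e , inj₁ (p , q))
  ... | inj₂ p | inj₁ q = inj₂ (e , inj₂ (q , p))
  ... | inj₂ p | inj₂ q = inj₁ (≡.trans (sym q) p)

  predecessor : ∀ {v n} → dist v ≡ suc n → ∃[ u ] ∃[ e ] (Joins G e u v × dist u ≡ n)
  predecessor {v} {n} d with em {v ∈ ball n}
  ... | yes v∈ = ⊥-elim (<-irrefl refl (≤-trans (≤-reflexive (sym d)) (dist-≤ v∈)))
  ... | no v∉ with ∈-++⁻ (ball n) (subst (λ k → v ∈ ball k) d (∈-ball-dist v))
  ... | inj₁ v∈ = ⊥-elim (v∉ v∈)
  ... | inj₂ v∈ with u , u∈ , v∈′ ← find (∈-concatMap⁻ neighbours {xs = ball n} v∈)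
               with ∈-neighbours v∈′
  ... | inj₁ refl    = ⊥-elim (v∉ u∈)
  ... | inj₂ (e , J) = u , e , J , ≤-antisym (dist-≤ u∈)
        (s≤s⁻¹ (≤-trans (≤-reflexive (sym d)) (dist-≤ (ball-joins (dist u) J (∈-ball-dist u)))))

-- The cut condition and a finite network satisfying it.

module Tokens (em : ExcludedMiddle 0ℓ) (G : Graph) (L : List (Graph.E G)) (L-! : Unique L) where
  open Graph G
  open Classical em
  open Cuts em G

  -- Each edge in L carries a token, at position p; F lists the edges still to
  -- be used.  By Menger, there are edge-disjoint trails in F that take all
  -- tokens to T iff every C ⊇ T has val F p C ≥ length L.
  val : List E → (E → V) → Region → ℕ
  val F p C = count (cross C) F + count (C ∘ p) L

  Bounded : Region → ℕ → List E → (E → V) → Set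
  Bounded T m F p = ∀ C → T ⊑ C → m ≤ val F p C

  Tight : Region → ℕ → List E → (E → V) → Region → Set
  Tight T m F p C = T ⊑ C × val F p C ≤ m

  Critical : Region → ℕ → List E → (E → V) → Set
  Critical T m F p = ∀ {e} → e ∈ F → Σ[ C ∈ Region ] (Tight T m F p C × cross C e ≡ true)

  submodular : ∀ F p C D → val F p (C ∩ D) + val F p (C ∪ D) ≤ val F p C + val F p D
  submodular F p C D = begin
    val F p (C ∩ D) + val F p (C ∪ D)
      ≡⟨ interchange (count (cross (C ∩ D)) F) _ _ _ ⟩
    (count (cross (C ∩ D)) F + count (cross (C ∪ D)) F) + (count ((C ∩ D) ∘ p) L + count ((C ∪ D) ∘ p) L)
      ≤⟨ +-mono-≤
           (total-mono₂ F λ e _ → submodular-xor (C (end₁ e)) (D (end₁ e)) (C (end₂ e)) (D (end₂ e)))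
           (total-mono₂ L λ x _ → ≤-reflexive (modular-𝟙 (C (p x)) (D (p x)))) ⟩
    (count (cross C) F + count (cross D) F) + (count (C ∘ p) L + count (D ∘ p) L)
      ≡⟨ interchange (count (cross C) F) _ _ _ ⟩
    val F p C + val F p D ∎
    where open ≤-Reasoning

  cancel-≤ : ∀ {a b c d m} → a + b ≤ c + d → c ≤ m → d ≤ m → m ≤ b → a ≤ m
  cancel-≤ {a} {m = m} le c≤ d≤ m≤ =
    +-cancelʳ-≤ m a m (≤-trans (+-monoʳ-≤ a m≤) (≤-trans le (+-mono-≤ c≤ d≤)))

  module _ {T m F p} (bounded : Bounded T m F p) where

    -- Uncrossing: the values of `C ∩ D` and `C ∪ D` add up to at most twice `m`, and neither is
    -- below `m`.
    tight-∩ : ∀ {C D} → Tight T m F p C → Tight T m F p D → Tight T m F p (C ∩ D)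
    tight-∩ {C} {D} (T⊑C , C≤) (T⊑D , D≤) =
      (λ v Tv → ∧-true⁺ (T⊑C v Tv) (T⊑D v Tv)) ,
      cancel-≤ (submodular F p C D) C≤ D≤ (bounded (C ∪ D) (λ v Tv → ∨-true⁺ˡ (T⊑C v Tv)))

    tight-∪ : ∀ {C D} → Tight T m F p C → Tight T m F p D → Tight T m F p (C ∪ D)
    tight-∪ {C} {D} (T⊑C , C≤) (T⊑D , D≤) =
      (λ v Tv → ∨-true⁺ˡ (T⊑C v Tv)) ,
      cancel-≤ (≤-trans (≤-reflexive (+-comm (val F p (C ∪ D)) _)) (submodular F p C D)) C≤ D≤
        (bounded (C ∩ D) (λ v Tv → ∧-true⁺ (T⊑C v Tv) (T⊑D v Tv)))

  val-⊆ : ∀ {F F′} p C → Unique F → F ⊆ F′ → val F p C ≤ val F′ p C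
  val-⊆ p C F-! F⊆F′ = +-monoˡ-≤ _ (count-⊆ (cross C) F-! F⊆F′)

  val-∷ : ∀ {F e F′} → F ↭ e ∷ F′ → ∀ p C → val F p C ≡ 𝟙 (cross C e) + val F′ p C
  val-∷ {e = e} F↭ p C =
    ≡.trans (cong (_+ count (C ∘ p) L) (total-↭ (𝟙 ∘ cross C) F↭)) (+-assoc (𝟙 (cross C e)) _ _)

  -- One augmentation step of Menger's theorem: call a vertex killed if finitely
  -- many additional edges destroy all tight sets containing it.  Unless T gets
  -- killed, the set of vertices not killed is a cut in which F has all edges.
  module Augment (B T : Region) (p : E → V) {t} (Tt : T t ≡ true) {k}
    (large : ∀ C → T ⊑ C → ∀ M → (∀ e → Within B e → cross C e ≡ true → e ∈ M) →
             k ≤ length M + count (C ∘ p) L)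
    {m F} (F-! : Unique F) (F-within : ∀ {e} → e ∈ F → Within B e) (bounded : Bounded T m F p)
    where

    record Killed (w : V) : Set where
      field
        edges    : List E
        edges-!  : Unique edges
        within   : ∀ {e} → e ∈ edges → Within B e
        extends  : F ⊆ edges
        kills    : ∀ C → Tight T m edges p C → C w ≡ false

    alive : Region
    alive v = not ⟦ Killed v ⟧

    alive⁻ : ∀ {v} → alive v ≡ true → ¬ Killed v
    alive⁻ a K = true≢false (⟦⟧⁺ K) (not-injective a)

    alive-false : ∀ {v} → alive v ≡ false → Killed v
    alive-false a = ⟦⟧⁻ (not-injective a)

    alive-true : ∀ {v} → ¬ Killed v → alive v ≡ true
    alive-true ¬K = cong not (⟦⟧-false ¬K)

    -- Add `e` to the edges that kill `u`. A set that is still tight misses `u`; if it contained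
    -- `w`, then `e` would cross it, and `F` together with `e` would already give it a value above
    -- `m`.
    kill-neighbour : ∀ {e u w} → Within B e → e ∉ F → Joins G e u w → Killed u → Killed w
    kill-neighbour {e} {u} {w} we e∉F J K = record
      { edges   = proj₁ more
      ; edges-! = proj₁ (proj₂ more)
      ; within  = proj₁ (proj₂ (proj₂ more))
      ; extends = λ x∈ → proj₂ (proj₂ (proj₂ more)) (there (extends x∈))
      ; kills   = kills′
      }
      where
      open Killed K

      more : Σ[ F′ ∈ List E ] (Unique F′ × (∀ {x} → x ∈ F′ → Within B x) × (e ∷ edges) ⊆ F′)
      more with em {e ∈ edges}
      ... | yes e∈ = edges , edges-! , within , λ { (here refl) → e∈ ; (there x∈) → x∈ }
      ... | no  e∉ = e ∷ edges , ∉⇒Unique e∉ edges-! , (λ { (here refl) → we ; (there x∈) → within x∈ }) , id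

      kills′ : ∀ C → Tight T m (proj₁ more) p C → C w ≡ false
      kills′ C (T⊑C , C≤) = ¬true λ Cw → <-irrefl refl (begin-strict
        m                                <⟨ s≤s (bounded C T⊑C) ⟩
        1 + val F p C                    ≡⟨ cong (λ b → 𝟙 b + val F p C) (cross-true C (joins-sym J) Cw Cu) ⟨
        𝟙 (cross C e) + val F p C        ≡⟨ val-∷ {F = e ∷ F} refl p C ⟨
        val (e ∷ F) p C                  ≤⟨ val-⊆ p C (∉⇒Unique e∉F F-!)
                                              (λ { (here refl) → proj₂ (proj₂ (proj₂ more)) (here refl)
                                                 ; (there x∈) → proj₂ (proj₂ (proj₂ more)) (there (extends x∈)) }) ⟩
        val (proj₁ more) p C             ≤⟨ C≤ ⟩
        m                                ∎)
        where
        open ≤-Reasoning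
        Cu : C u ≡ false
        Cu = kills C (T⊑C , ≤-trans (val-⊆ p C edges-! (proj₂ (proj₂ (proj₂ more)) ∘ there)) C≤)

    alive-cut : ∀ e → Within B e → cross alive e ≡ true → e ∈ F
    alive-cut e we cr with w , u , J , Aw , Au ← crossing-ends alive cr =
      by-contradiction λ e∉F → alive⁻ Aw (kill-neighbour we e∉F (joins-sym J) (alive-false Au))

    -- The edges that kill some `u` do not kill `w`, so after adding them some tight set still
    -- contains `w`. It misses `u`, and it was tight for the smaller list `F` too. These sets are
    -- intersected over `Y`.
    separate : ∀ {w} → ¬ Killed w → ∀ Y →
      Σ[ C ∈ Region ] (Tight T m F p C × C w ≡ true × (∀ {u} → u ∈ Y → Killed u → C u ≡ false))
    separate {w} ¬K [] = by-contradiction λ none → ¬K record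
      { edges = F ; edges-! = F-! ; within = F-within ; extends = id
      ; kills = λ C tight → ¬true λ Cw → none (C , tight , Cw , λ ()) }
    separate {w} ¬K (u ∷ Y) with C , tight , Cw , C∌ ← separate ¬K Y | em {Killed u}
    ... | no ¬Ku = C , tight , Cw , λ { (here refl) Ku → ⊥-elim (¬Ku Ku) ; (there u∈) → C∌ u∈ }
    ... | yes Ku = C ∩ D , tight-∩ {F = F} bounded tight (proj₁ D-props) , ∧-true⁺ Cw (proj₁ (proj₂ D-props)) , λ where
          (here refl) _  → ≡.trans (cong (C _ ∧_) (proj₂ (proj₂ D-props))) (∧-zeroʳ (C _))
          (there u∈)  K′ → cong (_∧ D _) (C∌ u∈ K′)
      where
      found : Σ[ D ∈ Region ] (Tight T m F p D × D w ≡ true × D u ≡ false)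
      found = by-contradiction λ none → ¬K record
        { edges = Killed.edges Ku ; edges-! = Killed.edges-! Ku ; within = Killed.within Ku
        ; extends = Killed.extends Ku
        ; kills = λ D tight′ → ¬true λ Dw → none
            ( D
            , (proj₁ tight′ , ≤-trans (val-⊆ p D F-! (Killed.extends Ku)) (proj₂ tight′))
            , Dw , Killed.kills Ku D tight′) }
      D       = proj₁ found
      D-props = proj₂ found

    -- The set `alive` is only a limit of tight sets, but on finitely many vertices it agrees with
    -- one: a union of sets from `separate`.
    approximate : ¬ Killed t → ∀ X Y →
      Σ[ C ∈ Region ] (Tight T m F p C × (∀ {w} → w ∈ Y → ¬ Killed w → C w ≡ true) ×
                       (∀ {u} → u ∈ X → Killed u → C u ≡ false))
    approximate ¬Kt X [] with C , tight , _ , C∌ ← separate ¬Kt X = C , tight , (λ ()) , C∌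
    approximate ¬Kt X (w ∷ Y) with C , tight , C∋ , C∌ ← approximate ¬Kt X Y | em {Killed w}
    ... | yes Kw = C , tight , (λ { (here refl) ¬K → ⊥-elim (¬K Kw) ; (there w∈) → C∋ w∈ }) , C∌
    ... | no ¬Kw with D , tight′ , Dw , D∌ ← separate ¬Kw X =
      C ∪ D , tight-∪ {F = F} bounded tight tight′
      , (λ { (here refl) _ → ∨-true⁺ʳ {C w} Dw ; (there w∈) ¬K → ∨-true⁺ˡ (C∋ w∈ ¬K) })
      , λ u∈ K → cong₂ _∨_ (C∌ u∈ K) (D∌ u∈ K)

    -- If `t` survived, `alive` would contain `T`, so `large` would give it a value of at least `k`.
    -- But `val` sees only the ends of `F` and the token positions, and there `alive` agrees with a
    -- tight set.
    target-killed : m < k → Killed t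
    target-killed m<k = by-contradiction λ ¬Kt → <⇒≱ m<k (begin
      k                                                       ≤⟨ large alive (T⊑alive ¬Kt) (select (cross alive) F)
                                                                   (λ e we cr → ∈-select⁺ (cross alive) (alive-cut e we cr) cr) ⟩
      length (select (cross alive) F) + count (alive ∘ p) L   ≡⟨ cong (_+ count (alive ∘ p) L) (length-select (cross alive) F) ⟩
      val F p alive                                           ≡⟨ agree ¬Kt ⟩
      val F p (proj₁ (approximate ¬Kt X X))                   ≤⟨ proj₂ (proj₁ (proj₂ (approximate ¬Kt X X))) ⟩
      m                                                       ∎)
      where
      open ≤-Reasoning

      X : List V
      X = ends F ++ map p L

      T⊑alive : ¬ Killed t → T ⊑ alive
      T⊑alive ¬Kt v Tv = alive-true λ K → ¬Kt record
        { edges = Killed.edges K ; edges-! = Killed.edges-! K ; within = Killed.within K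
        ; extends = Killed.extends K
        ; kills = λ C tight → true≢false (proj₁ tight v Tv) (Killed.kills K C tight) }

      agree : ∀ ¬Kt → val F p alive ≡ val F p (proj₁ (approximate ¬Kt X X))
      agree ¬Kt with C , _ , C∋ , C∌ ← approximate ¬Kt X X = cong₂ _+_
        (total-cong F λ e e∈ → cong 𝟙 (cong₂ _xor_
          (same (∈-++⁺ˡ (∈-ends {M = F} (inj₁ refl) e∈))) (same (∈-++⁺ˡ (∈-ends {M = F} (inj₂ refl) e∈)))))
        (total-cong L λ x x∈ → cong 𝟙 (same (∈-++⁺ʳ (ends F) (∈-map⁺ p x∈))))
        where
        same : ∀ {v} → v ∈ X → alive v ≡ C v
        same {v} v∈ with alive v in eq
        ... | true  = sym (C∋ v∈ (alive⁻ eq))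
        ... | false = sym (C∌ v∈ (alive-false eq))

  -- Every tight set contains `t`. Once `t` is killed no tight set is left, so the bound rises from
  -- `m` to `suc m`.
  finite-bounded : ∀ B T p {t} → T t ≡ true → ∀ {k} →
    (∀ C → T ⊑ C → ∀ M → (∀ e → Within B e → cross C e ≡ true → e ∈ M) →
      k ≤ length M + count (C ∘ p) L) →
    ∀ m → m ≤ k → Σ[ F ∈ List E ] (Unique F × (∀ {e} → e ∈ F → Within B e) × Bounded T m F p)
  finite-bounded B T p Tt large zero    _   = [] , [] , (λ ()) , λ _ _ → z≤n
  finite-bounded B T p Tt large (suc m) m<k
    with F , F-! , F-within , bounded ← finite-bounded B T p Tt large m (<⇒≤ m<k)
    = edges , edges-! , within , λ C T⊑C → ≰⇒> λ C≤ → true≢false (T⊑C _ Tt) (kills C (T⊑C , C≤))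
    where open Augment.Killed (Augment.target-killed B T p Tt large F-! F-within bounded m<k)

  -- In a shortest network an edge crossing no tight set could be dropped: each set that it crosses
  -- has a unit to spare.
  critical-edges : ∀ B T p {t} → T t ≡ true → ∀ {k} →
    (∀ C → T ⊑ C → ∀ M → (∀ e → Within B e → cross C e ≡ true → e ∈ M) →
      k ≤ length M + count (C ∘ p) L) →
    Σ[ F ∈ List E ] (Unique F × (∀ {e} → e ∈ F → Within B e) × Bounded T k F p × Critical T k F p)
  critical-edges B T p Tt {k} large
    with F₀ , props ← finite-bounded B T p Tt large k ≤-refl
    with least (λ n → Σ[ F ∈ List E ] ((Unique F × (∀ {e} → e ∈ F → Within B e) × Bounded T k F p) × length F ≡ n))
           (_ , F₀ , props , refl)
  ... | _ , (F , (F-! , F-within , bounded) , refl) , min = F , F-! , F-within , bounded , critical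
    where
    critical : Critical T k F p
    critical {e} e∈ = by-contradiction λ none → <⇒≱ (≤-reflexive (sym (↭-length F↭)))
      (min (length F′) (F′ , (Unique-tail (Unique-resp-↭ F↭ F-!) ,
        (λ x∈ → F-within (∈-resp-↭ (↭-sym F↭) (there x∈))) , bounded′ none) , refl))
      where
      F′ : List E
      F′ = proj₁ (extract e∈)

      F↭ : F ↭ e ∷ F′
      F↭ = proj₂ (extract e∈)

      bounded′ : ¬ (Σ[ C ∈ Region ] (Tight T k F p C × cross C e ≡ true)) → Bounded T k F′ p
      bounded′ none C T⊑C with cross C e in cr
      ... | true  = s≤s⁻¹ (≤-trans (≰⇒> λ C≤ → none (C , (T⊑C , C≤) , cr))
                      (≤-reflexive (≡.trans (val-∷ F↭ p C) (cong (λ b → 𝟙 b + val F′ p C) cr))))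
      ... | false = ≤-trans (bounded C T⊑C)
                      (≤-reflexive (≡.trans (val-∷ F↭ p C) (cong (λ b → 𝟙 b + val F′ p C) cr)))

-- Moving one token along one edge.

module Moves (em : ExcludedMiddle 0ℓ) (G : Graph) (L : List (Graph.E G)) (L-! : Unique L) where
  open Graph G
  open Classical em
  open Cuts em G
  open Tokens em G L L-!

  _[_↦_] : {A : Set} → (E → A) → E → A → E → A
  (p [ x ↦ w ]) y with x ≡? y
  ... | yes _ = w
  ... | no  _ = p y

  ↦-same : ∀ {A : Set} (p : E → A) x w → (p [ x ↦ w ]) x ≡ w
  ↦-same p x w with x ≡? x
  ... | yes _  = refl
  ... | no x≢x = ⊥-elim (x≢x refl)

  ↦-other : ∀ {A : Set} (p : E → A) x w {y} → x ≢ y → (p [ x ↦ w ]) y ≡ p y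
  ↦-other p x w {y} x≢y with x ≡? y
  ... | yes x≡y = ⊥-elim (x≢y x≡y)
  ... | no _    = refl

  𝟙-mono : ∀ {a b} → (a ≡ true → b ≡ true) → 𝟙 a ≤ 𝟙 b
  𝟙-mono {true}  a⇒b = ≤-reflexive (cong 𝟙 (sym (a⇒b refl)))
  𝟙-mono {false} a⇒b = z≤n

  module _ {T F p x} (F-! : Unique F) (x∈L : x ∈ L)
    (bounded : Bounded T (length L) F p) (critical : Critical T (length L) F p)
    (¬arrived : T (p x) ≡ false) where

    private
      v : V
      v = p x

      L′ : List E
      L′ = proj₁ (extract x∈L)

      L↭ : L ↭ x ∷ L′
      L↭ = proj₂ (extract x∈L)

      x∉L′ : x ∉ L′
      x∉L′ = Unique⇒∉ (Unique-resp-↭ L↭ L-!)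

      count-L : ∀ (C : Region) q → count (C ∘ q) L ≡ 𝟙 (C (q x)) + count (C ∘ q) L′
      count-L C q = total-↭ (𝟙 ∘ C ∘ q) L↭

    Out : E → Set
    Out e = e ∈ F × ∃[ w ] (Joins G e v w ×
      Σ[ C ∈ Region ] (Tight T (length L) F p C × C v ≡ false × C w ≡ true))

    -- If every edge at v leads out of a tight set containing v, then removing v
    -- from the intersection of these sets lowers val, contradicting the bound.
    outgoing : ∃[ e ] Out e
    outgoing = by-contradiction λ none →
      let C , (T⊑C , C≤) , Cv , closed = trap none F id
      in <⇒≱ (≤-trans (drop C Cv closed) C≤)
           (bounded (λ u → C u ∧ not ⟦ u ≡ v ⟧) λ u Tu → ∧-true⁺ (T⊑C u Tu)
             (cong not (⟦⟧-false λ { refl → true≢false Tu ¬arrived })))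
      where
      trap : ¬ ∃ Out → ∀ Y → Y ⊆ F →
        Σ[ C ∈ Region ] (Tight T (length L) F p C × C v ≡ true ×
                         (∀ {e} → e ∈ Y → ∀ {w} → Joins G e v w → C w ≡ false))
      -- The intersection starts from the whole vertex set, which is tight: no edge crosses it and
      -- it holds all tokens.
      trap none [] _ = (λ _ → true) , ((λ _ _ → refl) , everything) , refl , λ ()
        where
        everything : val F p (λ _ → true) ≤ length L
        everything = +-mono-≤
          (≤-trans (total-mono F (λ _ _ → ≤-refl)) (≤-reflexive (zero-total F)))
          (count≤length (λ _ → true) L)
          where
          zero-total : ∀ (M : List E) → total (λ _ → 0) M ≡ 0
          zero-total []      = refl
          zero-total (_ ∷ M) = zero-total M
      trap none (e ∷ Y) Y⊆F
        with C , tight , Cv , closed ← trap none Y (Y⊆F ∘ there) | em {∃[ w ] Joins G e v w}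
      ... | no away = C , tight , Cv , λ { (here refl) J → ⊥-elim (away (_ , J)) ; (there e∈) → closed e∈ }
      ... | yes (w , J) with D , tight′ , cr ← critical (Y⊆F (here refl)) | D v in Dv
      ... | true = C ∩ D , tight-∩ {F = F} bounded tight tight′ , ∧-true⁺ Cv Dv , λ where
              (here refl) J′ → ≡.trans (cong (C _ ∧_) (¬true λ Dw → true≢false cr (cross-false D J′ (≡.trans Dv (sym Dw)))))
                                 (∧-zeroʳ (C _))
              (there e∈)  J′ → cong (_∧ D _) (closed e∈ J′)
      ... | false = ⊥-elim (none (e , Y⊆F (here refl) , w , J , D , tight′ , Dv ,
              by-contradiction λ Dw → true≢false cr (cross-false D J (≡.trans Dv (sym (¬true Dw))))))

      drop : ∀ C → C v ≡ true → (∀ {e} → e ∈ F → ∀ {w} → Joins G e v w → C w ≡ false) →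
             val F p (λ u → C u ∧ not ⟦ u ≡ v ⟧) < val F p C
      drop C Cv closed = +-mono-≤-< edges tokens
        where
        D : Region
        D u = C u ∧ not ⟦ u ≡ v ⟧

        edges : count (cross D) F ≤ count (cross C) F
        edges = total-mono F λ e e∈ → 𝟙-mono λ cr →
          let u , w , J , Du , Dw = crossing-ends D cr
              Cu , u≢v = ∧-true Du
          in cross-true C J Cu (¬true λ Cw → case em {w ≡ v} of λ where
               (yes w≡v) → true≢false Cu (closed e∈ (subst (λ z → Joins G e z u) w≡v (joins-sym J)))
               (no w≢v)  → true≢false (∧-true⁺ Cw (cong not (⟦⟧-false w≢v))) Dw)

        tokens : count (D ∘ p) L < count (C ∘ p) L
        tokens = begin-strict
          count (D ∘ p) L                     ≡⟨ count-L D p ⟩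
          𝟙 (D v) + count (D ∘ p) L′          ≡⟨ cong (λ b → 𝟙 b + count (D ∘ p) L′) Dv ⟩
          count (D ∘ p) L′                    <⟨ s≤s (total-mono L′ λ y _ → 𝟙-mono λ Dy → proj₁ (∧-true Dy)) ⟩
          1 + count (C ∘ p) L′                ≡⟨ cong (λ b → 𝟙 b + count (C ∘ p) L′) Cv ⟨
          𝟙 (C v) + count (C ∘ p) L′          ≡⟨ count-L C p ⟨
          count (C ∘ p) L                     ∎
          where
          open ≤-Reasoning
          Dv : D v ≡ false
          Dv = ≡.trans (cong (λ b → C v ∧ not b) (⟦⟧⁺ refl)) (∧-zeroʳ (C v))

    module _ {e F′ w C} (F↭ : F ↭ e ∷ F′) (J : Joins G e v w)
      (tight : Tight T (length L) F p C) (Cv : C v ≡ false) (Cw : C w ≡ true) where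

      private
        p′ : E → V
        p′ = p [ x ↦ w ]

        same-L′ : ∀ X → count (X ∘ p′) L′ ≡ count (X ∘ p) L′
        same-L′ X = total-cong L′ λ y y∈ → cong (𝟙 ∘ X) (↦-other p x w λ { refl → x∉L′ y∈ })

        rearrange : ∀ c w r cr v → c + (w + r) + (cr + v) ≡ (cr + (c + (v + r))) + w
        rearrange = solve-∀

        -- Both sides are sums, so that no truncated subtraction occurs. The four cases of `X v` and
        -- `X w` show that the move changes the value only for sets containing `v` but not `w`,
        -- which lose 2.
        val-move : ∀ X → val F′ p′ X + (𝟙 (cross X e) + 𝟙 (X v)) ≡ val F p X + 𝟙 (X w)
        val-move X = begin
          val F′ p′ X + (𝟙 (cross X e) + 𝟙 (X v))
            ≡⟨ cong (λ n → count (cross X) F′ + n + (𝟙 (cross X e) + 𝟙 (X v)))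
                 (≡.trans (count-L X p′) (cong₂ _+_ (cong (𝟙 ∘ X) (↦-same p x w)) (same-L′ X))) ⟩
          count (cross X) F′ + (𝟙 (X w) + count (X ∘ p) L′) + (𝟙 (cross X e) + 𝟙 (X v))
            ≡⟨ rearrange (count (cross X) F′) (𝟙 (X w)) (count (X ∘ p) L′) (𝟙 (cross X e)) (𝟙 (X v)) ⟩
          𝟙 (cross X e) + (count (cross X) F′ + (𝟙 (X v) + count (X ∘ p) L′)) + 𝟙 (X w)
            ≡⟨ cong (λ n → 𝟙 (cross X e) + (count (cross X) F′ + n) + 𝟙 (X w)) (count-L X p) ⟨
          𝟙 (cross X e) + val F′ p X + 𝟙 (X w)
            ≡⟨ cong (_+ 𝟙 (X w)) (val-∷ F↭ p X) ⟨
          val F p X + 𝟙 (X w) ∎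
          where open ≡-Reasoning

        cross-e : ∀ X → cross X e ≡ X v xor X w
        cross-e X = cross-joins X J

        val-keep : ∀ X {a b} → X v ≡ a → X w ≡ b → 𝟙 (a xor b) + 𝟙 a ≡ 𝟙 b → val F′ p′ X ≡ val F p X
        val-keep X {a} {b} Xv Xw eq = +-cancelʳ-≡ (𝟙 b) _ _ (begin
          val F′ p′ X + 𝟙 b                           ≡⟨ cong (val F′ p′ X +_) eq ⟨
          val F′ p′ X + (𝟙 (a xor b) + 𝟙 a)           ≡⟨ cong (val F′ p′ X +_) (cong₂ _+_
                                                            (cong 𝟙 (≡.trans (cross-e X) (cong₂ _xor_ Xv Xw))) (cong 𝟙 Xv)) ⟨
          val F′ p′ X + (𝟙 (cross X e) + 𝟙 (X v))     ≡⟨ val-move X ⟩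
          val F p X + 𝟙 (X w)                         ≡⟨ cong (λ c → val F p X + 𝟙 c) Xw ⟩
          val F p X + 𝟙 b                             ∎)
          where open ≡-Reasoning

        val-exit : ∀ X → X v ≡ true → X w ≡ false → val F′ p′ X + 2 ≡ val F p X
        val-exit X Xv Xw = begin
          val F′ p′ X + 2                             ≡⟨ cong (val F′ p′ X +_) (cong₂ _+_
                                                            (cong 𝟙 (≡.trans (cross-e X) (cong₂ _xor_ Xv Xw))) (cong 𝟙 Xv)) ⟨
          val F′ p′ X + (𝟙 (cross X e) + 𝟙 (X v))     ≡⟨ val-move X ⟩
          val F p X + 𝟙 (X w)                         ≡⟨ cong (λ c → val F p X + 𝟙 c) Xw ⟩
          val F p X + 0                               ≡⟨ +-identityʳ _ ⟩
          val F p X                                   ∎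
          where open ≡-Reasoning

        val-≤ : ∀ X → val F′ p′ X ≤ val F p X
        val-≤ X with X v in Xv | X w in Xw
        ... | true  | true  = ≤-reflexive (val-keep X Xv Xw refl)
        ... | true  | false = ≤-trans (m≤m+n _ 2) (≤-reflexive (val-exit X Xv Xw))
        ... | false | true  = ≤-reflexive (val-keep X Xv Xw refl)
        ... | false | false = ≤-reflexive (val-keep X Xv Xw refl)

        val-uncrossed : ∀ X → X v ≡ X w → val F p X ≡ val F′ p X
        val-uncrossed X eq = ≡.trans (val-∷ F↭ p X) (cong (λ b → 𝟙 b + val F′ p X) (cross-false X J eq))

        val-crossed : ∀ X → X v ≡ not (X w) → val F p X ≡ 1 + val F′ p X
        val-crossed X eq = ≡.trans (val-∷ F↭ p X) (cong (λ b → 𝟙 b + val F′ p X)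
          (≡.trans (cross-e X) (≡.trans (cong (_xor X w) eq) (not-xor (X w)))))
          where
          not-xor : ∀ b → not b xor b ≡ true
          not-xor true  = refl
          not-xor false = refl

      bounded-move : Bounded T (length L) F′ p′
      bounded-move X T⊑X with X v in Xv | X w in Xw
      ... | true  | true  = ≤-trans (bounded X T⊑X) (≤-reflexive (sym (val-keep X Xv Xw refl)))
      ... | false | true  = ≤-trans (bounded X T⊑X) (≤-reflexive (sym (val-keep X Xv Xw refl)))
      ... | false | false = ≤-trans (bounded X T⊑X) (≤-reflexive (sym (val-keep X Xv Xw refl)))
      -- Here e joins X ∖ C to C ∖ X, so submodularity for X and C holds with 2 to spare.
      ... | true  | false = +-cancelʳ-≤ 2 _ _ (≤-trans k+2≤ (≤-reflexive (sym (val-exit X Xv Xw))))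
        where
        k : ℕ
        k = length L

        k≤∩ : k ≤ val F′ p (X ∩ C)
        k≤∩ = ≤-trans (bounded (X ∩ C) (λ u Tu → ∧-true⁺ (T⊑X u Tu) (proj₁ tight u Tu)))
          (≤-reflexive (val-uncrossed (X ∩ C) (≡.trans (cong₂ _∧_ Xv Cv) (sym (cong₂ _∧_ Xw Cw)))))

        k≤∪ : k ≤ val F′ p (X ∪ C)
        k≤∪ = ≤-trans (bounded (X ∪ C) (λ u Tu → ∨-true⁺ˡ (T⊑X u Tu)))
          (≤-reflexive (val-uncrossed (X ∪ C) (≡.trans (cong₂ _∨_ Xv Cv) (sym (cong₂ _∨_ Xw Cw)))))

        C<k : 1 + val F′ p C ≤ k
        C<k = ≤-trans (≤-reflexive (sym (val-crossed C (≡.trans Cv (sym (cong not Cw)))))) (proj₂ tight)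

        X-crossed : val F p X ≡ 1 + val F′ p X
        X-crossed = val-crossed X (≡.trans Xv (sym (cong not Xw)))

        k+2≤ : k + 2 ≤ val F p X
        k+2≤ = +-cancelʳ-≤ k _ _ (begin
          k + 2 + k                                     ≡⟨ rearr k ⟩
          2 + (k + k)                                   ≤⟨ +-monoʳ-≤ 2 (+-mono-≤ k≤∩ k≤∪) ⟩
          2 + (val F′ p (X ∩ C) + val F′ p (X ∪ C))     ≤⟨ +-monoʳ-≤ 2 (submodular F′ p X C) ⟩
          2 + (val F′ p X + val F′ p C)                 ≡⟨ rearr′ (val F′ p X) _ ⟩
          (1 + val F′ p X) + (1 + val F′ p C)           ≤⟨ +-mono-≤ (≤-reflexive (sym X-crossed)) C<k ⟩
          val F p X + k                                 ∎)
          where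
          open ≤-Reasoning
          rearr : ∀ k → k + 2 + k ≡ 2 + (k + k)
          rearr = solve-∀
          rearr′ : ∀ a b → 2 + (a + b) ≡ (1 + a) + (1 + b)
          rearr′ = solve-∀

      -- A move raises no value, so the tight sets crossed by the remaining edges stay tight.
      critical-move : Critical T (length L) F′ p′
      critical-move e∈ with D , (T⊑D , D≤) , cr ← critical (∈-resp-↭ (↭-sym F↭) (there e∈)) =
        D , (T⊑D , ≤-trans (val-≤ D) D≤) , cr

-- Routing the tokens from core to core.

module Routing (em : ExcludedMiddle 0ℓ) (G : Graph) (locally-finite : LocallyFinite G)
               (connected : Connected G) (r : Graph.V G)
               (S : Ray G) (K₀ : Cores.Core em G S) where
  open Graph G
  open Classical em
  open Cuts em G
  open Cores em G
  open Distances em G locally-finite connected r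
  open Core using (region; border; border-!; covers; tail; minimal)

  L : List E
  L = border K₀

  open Tokens em G L (border-! K₀)
  open Moves em G L (border-! K₀)

  -- p gives the positions of the tokens and ℓ the edges they used last.
  record Checkpoint (K : Core S) (p : E → V) (ℓ : E → E) : Set where
    field
      on-border : ∀ {x} → x ∈ L → cross (region K) (ℓ x) ≡ true
      inside    : ∀ {x} → x ∈ L → region K (p x) ≡ true
      at-end    : ∀ {x} → x ∈ L → Incident G (p x) (ℓ x)
      injective : ∀ {x y} → x ∈ L → y ∈ L → ℓ x ≡ ℓ y → x ≡ y

  module _ {K p ℓ} (checkpoint : Checkpoint K p ℓ) where
    open Checkpoint checkpoint

    private
      B : Region
      B = region K

    outer-false : ∀ {x w} → x ∈ L → Joins G (ℓ x) (p x) w → B w ≡ false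
    outer-false x∈ J = ¬true λ Bw →
      true≢false (on-border x∈) (cross-false B J (≡.trans (inside x∈) (sym Bw)))

    -- Replacing C by C ∩ B, minimality of K bounds |∂K| by the crossing edges
    -- inside B and the edges of ∂K ending in C; the rest of ∂K contains the
    -- last edges of all tokens outside C.
    checkpoint-large : ∀ {T} → T ⊑ B → Eventually S T →
      ∀ C → T ⊑ C → ∀ M → (∀ e → Within B e → cross C e ≡ true → e ∈ M) →
      length L ≤ length M + count (C ∘ p) L
    checkpoint-large {T} T⊑B ev C T⊑C M inM = begin
      length L                                                ≡⟨ count-not (C ∘ p) L ⟨
      count (C ∘ p) L + count (not ∘ C ∘ p) L                 ≤⟨ +-monoʳ-≤ (count (C ∘ p) L) outside ⟩
      count (C ∘ p) L + length M                              ≡⟨ +-comm (count (C ∘ p) L) _ ⟩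
      length M + count (C ∘ p) L                              ∎
      where
      open ≤-Reasoning

      touches : E → Bool
      touches e = (C ∩ B) (end₁ e) ∨ (C ∩ B) (end₂ e)

      touches⁺ : ∀ {e u} → Incident G u e → (C ∩ B) u ≡ true → touches e ≡ true
      touches⁺ (inj₁ refl) Cu = ∨-true⁺ˡ Cu
      touches⁺ {e} (inj₂ refl) Cu = ∨-true⁺ʳ {(C ∩ B) (end₁ e)} Cu

      touches⁻ : ∀ {e u v} → Joins G e u v → touches e ≡ true → (C ∩ B) u ≡ true ⊎ (C ∩ B) v ≡ true
      touches⁻ (inj₁ (refl , refl)) t = ∨-true t
      touches⁻ (inj₂ (refl , refl)) t = [ inj₂ , inj₁ ]′ (∨-true t)

      covered : Covers (C ∩ B) (M ++ select touches (border K))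
      covered e cr with u , v , J , CBu , CBv ← crossing-ends (C ∩ B) cr | B v in Bv
      ... | false = ∈-++⁺ʳ M (∈-select⁺ touches
                      (covers K e (cross-true B J (proj₂ (∧-true CBu)) Bv)) (touches⁺ (joins-incident J) CBu))
      ... | true  = ∈-++⁺ˡ (inM e (within J (proj₂ (∧-true CBu)) Bv)
                      (cross-true C J (proj₁ (∧-true CBu)) (¬true λ Cv → true≢false (∧-true⁺ Cv refl) CBv)))
        where
        within : ∀ {u v} → Joins G e u v → B u ≡ true → B v ≡ true → Within B e
        within (inj₁ (refl , refl)) p q = p , q
        within (inj₂ (refl , refl)) p q = q , p

      untouched : count (not ∘ touches) (border K) ≤ length M
      untouched = +-cancelˡ-≤ (count touches (border K)) _ _ (begin
        count touches (border K) + count (not ∘ touches) (border K)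
          ≡⟨ count-not touches (border K) ⟩
        length (border K)
          ≤⟨ minimal K (C ∩ B) (λ v → proj₂ ∘ ∧-true)
               (eventually-∧ S C B (eventually-⊑ S T⊑C ev) (eventually-⊑ S T⊑B ev)) covered ⟩
        length (M ++ select touches (border K))
          ≡⟨ length-++ M ⟩
        length M + length (select touches (border K))
          ≡⟨ cong (length M +_) (length-select touches (border K)) ⟩
        length M + count touches (border K)
          ≡⟨ +-comm (length M) _ ⟩
        count touches (border K) + length M ∎)

      far-tokens : List E
      far-tokens = select (not ∘ C ∘ p) L

      map-! : ∀ {xs} → Unique xs → xs ⊆ L → Unique (map ℓ xs)
      map-! {[]}     _ _ = []
      map-! {x ∷ xs} u xs⊆L = ∉⇒Unique
        (λ ℓx∈ → let y , y∈ , eq = ∈-map⁻ ℓ ℓx∈ in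
          Unique⇒∉ u (subst (_∈ xs) (sym (injective (xs⊆L (here refl)) (xs⊆L (there y∈)) eq)) y∈))
        (map-! (Unique-tail u) (xs⊆L ∘ there))

      far⊆L : far-tokens ⊆ L
      far⊆L = proj₁ ∘ ∈-select⁻ (not ∘ C ∘ p) L

      ℓ-far : map ℓ far-tokens ⊆ select (not ∘ touches) (border K)
      ℓ-far e∈ with x , x∈ , refl ← ∈-map⁻ ℓ e∈ =
        ∈-select⁺ (not ∘ touches) (covers K (ℓ x) (on-border (far⊆L x∈))) (cong not (¬true λ t →
          let w , J = incident-joins (at-end (far⊆L x∈)) in case touches⁻ J t of λ where
            (inj₁ CBp) → true≢false (proj₁ (∧-true CBp)) (not-injective (proj₂ (∈-select⁻ (not ∘ C ∘ p) L x∈)))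
            (inj₂ CBw) → true≢false (proj₂ (∧-true CBw)) (outer-false (far⊆L x∈) J)))

      far-! : Unique (map ℓ far-tokens)
      far-! = map-! (select-! (not ∘ C ∘ p) (border-! K₀)) far⊆L

      outside : count (not ∘ C ∘ p) L ≤ length M
      outside = begin
        count (not ∘ C ∘ p) L                            ≡⟨ length-select (not ∘ C ∘ p) L ⟨
        length far-tokens                                ≡⟨ length-map ℓ far-tokens ⟨
        length (map ℓ far-tokens)                        ≤⟨ Unique-⊆-length far-! ℓ-far ⟩
        length (select (not ∘ touches) (border K))       ≡⟨ length-select (not ∘ touches) (border K) ⟩
        count (not ∘ touches) (border K)                 ≤⟨ untouched ⟩
        length M                                         ∎

  -- `Fresh` edges are those that may still be traversed, in the current stage or in a later one.
  -- That the edge used last is never fresh, `stale`, makes the trails edge-disjoint. The field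
  -- `arrived` prepares the checkpoint at `goal`.
  record State : Set where
    field
      stage     : ℕ
      base goal : Core S
      F         : List E
      p         : E → V
      ℓ         : E → E

    Fresh : E → Set
    Fresh e = e ∈ F ⊎ Within (region goal) e

    field
      goal⊑base : region goal ⊑ region base
      base-far  : ∀ {v} → region base v ≡ true → stage ≤ dist v
      goal-far  : ∀ {v} → region goal v ≡ true → stage < dist v
      F-!       : Unique F
      F-within  : ∀ {e} → e ∈ F → Within (region base) e
      bounded   : Bounded (region goal) (length L) F p
      critical  : Critical (region goal) (length L) F p
      inside    : ∀ {x} → x ∈ L → region base (p x) ≡ true
      at-end    : ∀ {x} → x ∈ L → Incident G (p x) (ℓ x)
      injective : ∀ {x y} → x ∈ L → y ∈ L → ℓ x ≡ ℓ y → x ≡ y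
      arrived   : ∀ {x} → x ∈ L → region goal (p x) ≡ true → cross (region goal) (ℓ x) ≡ true
      stale     : ∀ {x} → x ∈ L → ¬ Fresh (ℓ x)

    fresh-within : ∀ {e} → Fresh e → Within (region base) e
    fresh-within (inj₁ e∈) = F-within e∈
    fresh-within (inj₂ wi) = within-⊑ goal⊑base wi

  new-stage : ∀ n K → (∀ {v} → region K v ≡ true → n ≤ dist v) →
              ∀ p ℓ → Checkpoint K p ℓ → State
  new-stage n K far p ℓ checkpoint = record
    { stage     = n
    ; base      = K
    ; goal      = proj₁ goal
    ; F         = F
    ; p         = p
    ; ℓ         = ℓ
    ; goal⊑base = goal⊑base
    ; base-far  = far
    ; goal-far  = λ {v} Tv → ∉-ball (λ v∈ → true≢false (⟦⟧⁺ v∈) (not-injective (proj₂ (∧-true (proj₂ goal v Tv)))))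
    ; F-!       = proj₁ F-props
    ; F-within  = proj₁ (proj₂ F-props)
    ; bounded   = proj₁ (proj₂ (proj₂ F-props))
    ; critical  = proj₂ (proj₂ (proj₂ F-props))
    ; inside    = inside
    ; at-end    = at-end
    ; injective = injective
    -- A token may lie in the new goal from the outset. Its last edge then crosses both borders,
    -- because the outer end of that edge is not even in `K`.
    ; arrived   = λ x∈ Tp → let w , J = incident-joins (at-end x∈) in
        cross-true T J Tp (¬true λ Tw → true≢false (goal⊑base w Tw) (outer-false checkpoint x∈ J))
    ; stale     = λ { x∈ (inj₁ e∈) → stale x∈ (proj₁ (proj₂ F-props) e∈)
                    ; x∈ (inj₂ wi) → stale x∈ (within-⊑ goal⊑base wi) }
    }
    where
    open Checkpoint checkpoint

    -- Deleting the ball drives successive cores away from `r`, so that no vertex lies in all of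
    -- them.
    goal : Σ[ K′ ∈ Core S ] (region K′ ⊑ λ v → region K v ∧ not ⟦ v ∈ ball n ⟧)
    goal = core-within S _ (covers-restrict (region K) (ball n) (covers K))
             (eventually-∧ S (region K) (λ v → not ⟦ v ∈ ball n ⟧) (tail K) (eventually-outside S (ball n)))

    T : Region
    T = region (proj₁ goal)

    goal⊑base : T ⊑ region K
    goal⊑base v = proj₁ ∘ ∧-true ∘ proj₂ goal v

    network : Σ[ F ∈ List E ] (Unique F × (∀ {e} → e ∈ F → Within (region K) e) ×
                               Bounded T (length L) F p × Critical T (length L) F p)
    network = critical-edges (region K) T p (proj₂ (tail (proj₁ goal)) _ ≤-refl)
                (checkpoint-large checkpoint goal⊑base (tail (proj₁ goal)))

    F       = proj₁ network
    F-props = proj₂ network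

    stale : ∀ {x} → x ∈ L → ¬ Within (region K) (ℓ x)
    stale {x} x∈ wi = true≢false (on-border x∈) (within-uncrossed {region K} {ℓ x} wi)

  record Step (s s′ : State) : Set where
    private
      module s  = State s
      module s′ = State s′
    field
      progress : s′.stage ≡ suc s.stage ⊎ (s′.stage ≡ s.stage × length s′.F < length s.F)
      shrinks  : region s′.base ⊑ region s.base
      fresh    : ∀ {e} → s′.Fresh e → s.Fresh e
      moves    : ∀ {x} → x ∈ L → (s′.p x ≡ s.p x × s′.ℓ x ≡ s.ℓ x) ⊎
                                 (Joins G (s′.ℓ x) (s.p x) (s′.p x) × s.Fresh (s′.ℓ x))

  move : ∀ s {x} → x ∈ L → region (State.goal s) (State.p s x) ≡ false → Σ[ s′ ∈ State ] Step s s′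
  move s {x} x∈L ¬arrived with outgoing F-! x∈L bounded critical ¬arrived
    where open State s
  ... | e , e∈F , w , J , C , tight , Cv , Cw = record
    { stage     = stage
    ; base      = base
    ; goal      = goal
    ; F         = F′
    ; p         = p′
    ; ℓ         = ℓ′
    ; goal⊑base = goal⊑base
    ; base-far  = base-far
    ; goal-far  = goal-far
    ; F-!       = Unique-tail eF′-!
    ; F-within  = λ e∈ → F-within (F′⊆F e∈)
    ; bounded   = bounded-move F-! x∈L bounded critical ¬arrived F↭ J tight Cv Cw
    ; critical  = critical-move F-! x∈L bounded critical ¬arrived F↭ J tight Cv Cw
    ; inside    = λ y∈ → by-token (λ v _ → region base v ≡ true)
                    (within-incident (region base) (F-within e∈F) (joins-incident (joins-sym J))) (λ _ → inside y∈)
    ; at-end    = λ y∈ → by-token (Incident G) (joins-incident (joins-sym J)) (λ _ → at-end y∈)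
    ; injective = injective′
    ; arrived   = λ y∈ → by-token (λ v f → region goal v ≡ true → cross (region goal) f ≡ true)
                    (λ Tw → cross-true (region goal) (joins-sym J) Tw ¬arrived) (λ _ → arrived y∈)
    ; stale     = λ y∈ → by-token (λ _ f → ¬ (f ∈ F′ ⊎ Within (region goal) f))
                    stale-e (λ _ → stale y∈ ∘ fresh′)
    } , record
    { progress = inj₂ (refl , ≤-reflexive (sym (↭-length F↭)))
    ; shrinks  = λ _ → id
    ; fresh    = fresh′
    ; moves    = moves
    }
    where
    open State s

    F′ = proj₁ (extract e∈F)
    F↭ = proj₂ (extract e∈F)
    p′ = p [ x ↦ w ]
    ℓ′ = ℓ [ x ↦ e ]

    eF′-! : Unique (e ∷ F′)
    eF′-! = Unique-resp-↭ F↭ F-!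

    F′⊆F : F′ ⊆ F
    F′⊆F e∈ = ∈-resp-↭ (↭-sym F↭) (there e∈)

    fresh′ : ∀ {f} → f ∈ F′ ⊎ Within (region goal) f → Fresh f
    fresh′ = map₁ F′⊆F

    by-token : ∀ (P : V → E → Set) {y} → P w e → (x ≢ y → P (p y) (ℓ y)) → P (p′ y) (ℓ′ y)
    by-token P {y} new old with x ≡? y
    ... | yes _  = new
    ... | no x≢y = old x≢y

    stale-e : ¬ (e ∈ F′ ⊎ Within (region goal) e)
    stale-e (inj₁ e∈F′) = Unique⇒∉ eF′-! e∈F′
    stale-e (inj₂ wi)   = true≢false (within-incident (region goal) wi (joins-incident J)) ¬arrived

    -- The edge `e` was fresh until now, whereas the last edges of all other tokens are stale.
    injective′ : ∀ {y z} → y ∈ L → z ∈ L → ℓ′ y ≡ ℓ′ z → y ≡ z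
    injective′ {y} {z} y∈ z∈ eq with x ≡? y | x ≡? z
    ... | yes refl | yes refl = refl
    ... | yes refl | no _     = ⊥-elim (stale z∈ (inj₁ (subst (_∈ F) eq e∈F)))
    ... | no _     | yes refl = ⊥-elim (stale y∈ (inj₁ (subst (_∈ F) (sym eq) e∈F)))
    ... | no _     | no _     = injective y∈ z∈ eq

    moves : ∀ {y} → y ∈ L → (p′ y ≡ p y × ℓ′ y ≡ ℓ y) ⊎ (Joins G (ℓ′ y) (p y) (p′ y) × Fresh (ℓ′ y))
    moves {y} y∈ with x ≡? y
    ... | yes refl = inj₂ (J , inj₁ e∈F)
    ... | no _     = inj₁ (refl , refl)

  advance : ∀ s → Σ[ s′ ∈ State ] Step s s′
  advance s with em {∃[ x ] (x ∈ L × region (State.goal s) (State.p s x) ≡ false)}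
  ... | yes (x , x∈L , ¬arrived) = move s x∈L ¬arrived
  ... | no none = s′ , record
    { progress = inj₁ refl
    ; shrinks  = goal⊑base
    ; fresh    = inj₂ ∘ State.fresh-within s′
    ; moves    = λ _ → inj₁ (refl , refl)
    }
    where
    open State s

    all-arrived : ∀ {x} → x ∈ L → region goal (p x) ≡ true
    all-arrived {x} x∈ = by-contradiction λ ¬T → none (x , x∈ , ¬true ¬T)

    s′ : State
    s′ = new-stage (suc stage) goal goal-far p ℓ record
      { on-border = λ x∈ → arrived x∈ (all-arrived x∈)
      ; inside    = all-arrived
      ; at-end    = at-end
      ; injective = injective
      }

-- From the infinite token run to edge-disjoint rays.

module CoreLinked (em : ExcludedMiddle 0ℓ) (G : Graph) (locally-finite : LocallyFinite G)
                  (connected : Connected G) (r : Graph.V G)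
                  (S : Ray G) (K₀ : Cores.Core em G S) where
  open Graph G
  open Classical em
  open Cuts em G
  open Cores em G
  open Distances em G locally-finite connected r
  open Core using (region; crosses; covers; tail)
  open Routing em G locally-finite connected r S K₀
  open Ray using (vertex; edge)

  B : Region
  B = region K₀

  outer inner : E → V
  outer e = if B (end₁ e) then end₂ e else end₁ e
  inner e = if B (end₁ e) then end₁ e else end₂ e

  outer-inner : ∀ {e} → cross B e ≡ true →
                Joins G e (outer e) (inner e) × B (outer e) ≡ false × B (inner e) ≡ true
  outer-inner {e} cr with B (end₁ e) in p | B (end₂ e) in q
  ... | true  | false = inj₂ (refl , refl) , q , p
  ... | false | true  = inj₁ (refl , refl) , p , q

  start : Checkpoint K₀ inner id
  start = record
    { on-border = crosses K₀
    ; inside    = λ x∈ → proj₂ (proj₂ (outer-inner (crosses K₀ x∈)))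
    ; at-end    = λ x∈ → joins-incident (joins-sym (proj₁ (outer-inner (crosses K₀ x∈))))
    ; injective = λ _ _ → id
    }

  run : ℕ → State
  run zero    = new-stage 0 K₀ (λ _ → z≤n) inner id start
  run (suc t) = proj₁ (advance (run t))

  module At (t : ℕ) where
    open State (run t) public
    open Step (proj₂ (advance (run t))) public

  stage-mono : ∀ k t → At.stage t ≤ At.stage (k + t)
  stage-mono zero    t = ≤-refl
  stage-mono (suc k) t = ≤-trans (stage-mono k t)
    ([ (λ eq → ≤-trans (n≤1+n _) (≤-reflexive (sym eq))) , (λ (eq , _) → ≤-reflexive (sym eq)) ]′
      (At.progress (k + t)))

  base-mono : ∀ k t → region (At.base (k + t)) ⊑ region (At.base t)
  base-mono zero    t v = id
  base-mono (suc k) t v = base-mono k t v ∘ At.shrinks (k + t) v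

  fresh-mono : ∀ k t {e} → At.Fresh (k + t) e → At.Fresh t e
  fresh-mono zero    t = id
  fresh-mono (suc k) t = fresh-mono k t ∘ At.fresh (k + t)

  -- Each move uses up an edge of the finite list `F`, so a stage comes to an end.
  next-stage : ∀ n t → length (At.F t) ≤ n → ∃[ t′ ] At.stage t′ ≡ suc (At.stage t)
  next-stage n t le with At.progress t
  ... | inj₁ eq = suc t , eq
  next-stage zero    t le | inj₂ (_ , lt) = ⊥-elim (n≮0 (≤-trans lt le))
  next-stage (suc n) t le | inj₂ (eq , lt) with t′ , eq′ ← next-stage n (suc t) (s≤s⁻¹ (≤-trans lt le)) =
    t′ , ≡.trans eq′ (cong suc eq)

  reaches-stage : ∀ n → ∃[ t ] n ≤ At.stage t
  reaches-stage zero    = 0 , z≤n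
  reaches-stage (suc n) with t , le ← reaches-stage n
    with t′ , eq ← next-stage (length (At.F t)) t ≤-refl = t′ , ≤-trans (s≤s le) (≤-reflexive (sym eq))

  -- An edge taken from time `t` on is fresh at time `t`, but the last edge of `x` is stale by then.
  -- So `y` has not moved in between, and injectivity at time `t` applies.
  same-token : ∀ k t {x y} → x ∈ L → y ∈ L → At.ℓ t x ≡ At.ℓ (k + t) y → x ≡ y
  same-token zero    t x∈ y∈ eq = At.injective t x∈ y∈ eq
  same-token (suc k) t x∈ y∈ eq with At.moves (k + t) y∈
  ... | inj₁ (_ , eq′) = same-token k t x∈ y∈ (≡.trans eq eq′)
  ... | inj₂ (_ , fr)  = ⊥-elim (At.stale t x∈ (subst (At.Fresh t) (sym eq) (fresh-mono k t fr)))

  module Token {x : E} (x∈L : x ∈ L) where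
    -- Shifted by one against `run`: the walk starts at the outer end, so its first step traverses
    -- the boundary edge `x` itself.
    position : ℕ → V
    position zero    = outer x
    position (suc t) = At.p t x

    moves : ∀ t → position (suc t) ≡ position t ⊎ Joins G (At.ℓ t x) (position t) (position (suc t))
    moves zero    = inj₂ (proj₁ (outer-inner (crosses K₀ x∈L)))
    moves (suc t) with At.moves t x∈L
    ... | inj₁ (eq , _) = inj₁ eq
    ... | inj₂ (J , _)  = inj₂ J

    position-base : ∀ k t → region (At.base t) (position (suc (k + t))) ≡ true
    position-base k t = base-mono k t _ (At.inside (k + t) x∈L)

    leaves : ∀ v → ∃[ N ] (∀ t → N ≤ t → position t ≢ v)
    leaves v with t , le ← reaches-stage (suc (dist v)) = suc t , away
      where
      away : ∀ t′ → suc t ≤ t′ → position t′ ≢ v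
      away (suc t′) (s≤s t≤t′) refl = <⇒≱ le (≤-trans
        (≤-trans (stage-mono (t′ ∸ t) t) (≤-reflexive (cong At.stage (m∸n+n≡m t≤t′))))
        (At.base-far t′ (At.inside t′ x∈L)))

    open LoopErasure position (λ t → At.ℓ t x) moves leaves public

    -- From time 1 on the walk stays in `B`, so it never returns to `outer x`, and loop erasure
    -- keeps the first step.
    first-edge : edge ray 0 ≡ x
    first-edge = cong (λ t → At.ℓ t x) (time-zero λ t eq →
      true≢false (≡.trans (cong B (sym eq))
        (subst (λ n → B (position (suc n)) ≡ true) (+-identityʳ t) (position-base t 0)))
        (proj₁ (proj₂ (outer-inner (crosses K₀ x∈L)))))

    last-used : ∀ t → At.ℓ t x ≡ x ⊎ Within B (At.ℓ t x)
    last-used zero    = inj₁ refl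
    last-used (suc t) with At.moves t x∈L
    ... | inj₁ (_ , eq) = subst (λ e → e ≡ x ⊎ Within B e) (sym eq) (last-used t)
    ... | inj₂ (_ , fr) = inj₂ (State.fresh-within (run 0)
            (fresh-mono t 0 (subst (λ n → At.Fresh n (At.ℓ (suc t) x)) (sym (+-identityʳ t)) fr)))

    -- The base of a late stage is connected, lies farther from `r` than all of `X`, and still
    -- contains vertices of both rays.
    ~-S : _~_ G ray S
    ~-S = equivalent ray S λ X →
      let n , bound = dist-bound X
          t , le    = reaches-stage n
          K         = At.base t
          N , inK   = tail K
      in region K , Core.connected K
       , (λ Kv v∈X → <⇒≱ (bound v∈X) (≤-trans le (At.base-far t Kv)))
       , (suc t , late {t} (n≤time (suc t)))
       , (N , inK N ≤-refl)
      where
      late : ∀ {t n} → suc t ≤ n → region (At.base t) (position n) ≡ true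
      late {t} {suc n} (s≤s t≤n) =
        subst (λ m → region (At.base t) (position (suc m)) ≡ true) (m∸n+n≡m t≤n) (position-base (n ∸ t) t)

  edge-disjoint : ∀ {x y} (x∈ : x ∈ L) (y∈ : y ∈ L) → x ≢ y → EdgeDisjoint G (Token.ray x∈) (Token.ray y∈)
  edge-disjoint {x} {y} x∈ y∈ x≢y m n eq with ≤-total (Token.time x∈ m) (Token.time y∈ n)
  ... | inj₁ le = x≢y (same-token (Token.time y∈ n ∸ Token.time x∈ m) (Token.time x∈ m) x∈ y∈
                    (≡.trans eq (cong (λ t → At.ℓ t y) (sym (m∸n+n≡m le)))))
  ... | inj₂ le = x≢y (sym (same-token (Token.time x∈ m ∸ Token.time y∈ n) (Token.time y∈ n) y∈ x∈
                    (≡.trans (sym eq) (cong (λ t → At.ℓ t x) (sym (m∸n+n≡m le))))))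

  -- That two rays equivalent to `S` are equivalent to each other enters as an argument; the
  -- numbering of the ends supplies it.
  boundary-linked : (∀ R R′ → _~_ G R S → _~_ G R′ S → _~_ G R R′) → BoundaryLinked G ⟨ B ⟩
  boundary-linked joinable =
    (Σ[ e ∈ E ] cross B e ≡ true) , ray , edges , disjoint , related ,
    λ e bd → (e , boundary⇒cross B bd) , Token.first-edge (covers K₀ e (boundary⇒cross B bd))
    where
    ray : (Σ[ e ∈ E ] cross B e ≡ true) → Ray G
    ray (e , cr) = Token.ray (covers K₀ e cr)

    edges : ∀ i n → Inside G ⟨ B ⟩ (edge (ray i) n) ⊎ Boundary G ⟨ B ⟩ (edge (ray i) n)
    edges (e , cr) n with Token.last-used (covers K₀ e cr) (Token.time (covers K₀ e cr) n)
    ... | inj₁ eq = inj₂ (subst (Boundary G ⟨ B ⟩) (sym eq) (cross⇒boundary B cr))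
    ... | inj₂ wi = inj₁ wi

    disjoint : ∀ i j → i ≢ j → EdgeDisjoint G (ray i) (ray j)
    disjoint (e , cr) (e′ , cr′) i≢j = edge-disjoint (covers K₀ e cr) (covers K₀ e′ cr′)
      λ { refl → i≢j (cong (e ,_) (Bool-irrelevant cr cr′)) }
      where
      Bool-irrelevant : {a b : Bool} (p q : a ≡ b) → p ≡ q
      Bool-irrelevant refl refl = refl

    related : ∀ i j → _~_ G (ray i) (ray j)
    related (e , cr) (e′ , cr′) = joinable
      (ray (e , cr)) (ray (e′ , cr′)) (Token.~-S (covers K₀ e cr)) (Token.~-S (covers K₀ e′ cr′))

-- Capturing the ends one after another.

module Packings (em : ExcludedMiddle 0ℓ) (G : Graph) (locally-finite : LocallyFinite G)
                (connected : Connected G) (r : Graph.V G)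
                (ends-countable : CountablyManyEnds G) (A′ : List (Graph.V G)) where
  open Graph G
  open Classical em
  open Cuts em G
  open Cores em G
  open Distances em G locally-finite connected r
  open Ray using (vertex)

  end : Ray G → ℕ
  end = proj₁ ends-countable

  end-cong : ∀ {R S} → _~_ G R S → end R ≡ end S
  end-cong = proj₁ (proj₂ ends-countable)

  end-injective : ∀ {R S} → end R ≡ end S → _~_ G R S
  end-injective = proj₂ (proj₂ ends-countable)

  -- By `sealed` no edge joins the piece to the rest of `U`; as it is connected, it is a component
  -- of `U`.
  record Piece (U : Region) (v : V) : Set₁ where
    field
      region  : Region
      member  : region v ≡ true
      within  : region ⊑ U
      linked  : BoundaryLinked G ⟨ region ⟩
      conn    : ConnectedOn G ⟨ region ⟩
      sealed  : ∀ e → cross region e ≡ true → cross U e ≡ true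

  -- The pieces are the components of U.
  record Packing : Set₁ where
    field
      U      : Region
      border : List E
      covers : Covers U border
      avoids : ∀ {v} → U v ≡ true → v ∉ A′
      piece  : ∀ v → U v ≡ true → Piece U v

  empty : Packing
  empty = record { U = λ _ → false ; border = [] ; covers = λ _ () ; avoids = λ () ; piece = λ _ () }

  add : ∀ (Q : Packing) S → ¬ Eventually S (Packing.U Q) →
    Σ[ Q′ ∈ Packing ] (Packing.U Q ⊑ Packing.U Q′ × (∀ R → end R ≡ end S → Eventually R (Packing.U Q′)))
  add Q S ¬ev = record
    { U      = U ∪ B
    ; border = border ++ Core.border K
    ; covers = covers′
    ; avoids = avoids′
    ; piece  = piece′
    } , (λ v → ∨-true⁺ˡ)
      , λ R eq → eventually-⊑ R {B} (λ v → ∨-true⁺ʳ {U v})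
          (eventually-~ {R} {S} (end-injective {R} {S} eq) B (Core.covers K) (Core.tail K))
    where
    open Packing Q

    X : List V
    X = A′ ++ ends border

    covers-not : Covers (not ∘ U) border
    covers-not e cr = covers e (≡.trans (sym (xor-not (U (end₁ e)) (U (end₂ e)))) cr)
      where
      xor-not : ∀ a b → not a xor not b ≡ a xor b
      xor-not true  true  = refl
      xor-not true  false = refl
      xor-not false true  = refl
      xor-not false false = refl

    outside : Eventually S (not ∘ U)
    outside = [ (λ ev → ⊥-elim (¬ev ev)) , id ]′ (settles S U covers)

    core : Σ[ K ∈ Core S ] (Core.region K ⊑ λ v → not (U v) ∧ not ⟦ v ∈ X ⟧)
    core = core-within S _ (covers-restrict (not ∘ U) X covers-not)
             (eventually-∧ S (not ∘ U) (λ v → not ⟦ v ∈ X ⟧) outside (eventually-outside S X))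

    K : Core S
    K = proj₁ core

    B : Region
    B = Core.region K

    B-outside : ∀ {v} → B v ≡ true → U v ≡ false
    B-outside Bv = not-injective (proj₁ (∧-true (proj₂ core _ Bv)))

    B-avoids : ∀ {v} → B v ≡ true → v ∉ X
    B-avoids Bv v∈ = true≢false (⟦⟧⁺ v∈) (not-injective (proj₂ (∧-true (proj₂ core _ Bv))))

    -- An edge between `U` and the core would cross `U`, so its end in the core would be one of the
    -- excluded ends of `border`. Hence old and new pieces do not merge.
    B-sealed : ∀ {e u v} → Joins G e u v → B v ≡ true → U u ≡ true → ∀ {A : Set} → A
    B-sealed J Bv Uu = ⊥-elim (B-avoids Bv (∈-++⁺ʳ A′
      (∈-ends (joins-incident (joins-sym J)) (covers _ (cross-true U J Uu (B-outside Bv))))))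

    covers′ : Covers (U ∪ B) (border ++ Core.border K)
    covers′ e cr with u , v , J , UBu , UBv ← crossing-ends (U ∪ B) cr with ∨-true UBu
    ... | inj₁ Uu = ∈-++⁺ˡ (covers e (cross-true U J Uu (¬true λ Uv → true≢false (∨-true⁺ˡ Uv) UBv)))
    ... | inj₂ Bu = ∈-++⁺ʳ border (Core.covers K e
                      (cross-true B J Bu (¬true λ Bv → true≢false (∨-true⁺ʳ {U v} Bv) UBv)))

    avoids′ : ∀ {v} → (U ∪ B) v ≡ true → v ∉ A′
    avoids′ UBv with ∨-true UBv
    ... | inj₁ Uv = avoids Uv
    ... | inj₂ Bv = B-avoids Bv ∘ ∈-++⁺ˡ

    piece′ : ∀ v → (U ∪ B) v ≡ true → Piece (U ∪ B) v
    piece′ v UBv with ∨-true UBv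
    ... | inj₁ Uv = record
      { region = region
      ; member = member
      ; within = λ w → ∨-true⁺ˡ ∘ within w
      ; linked = linked
      ; conn   = conn
      ; sealed = λ e cr → let u , w , J , Uu , Uw = crossing-ends U (sealed e cr) in
          cross-true (U ∪ B) J (∨-true⁺ˡ Uu) (cong₂ _∨_ Uw (¬true λ Bw → B-sealed J Bw Uu))
      }
      where open Piece (piece v Uv)
    ... | inj₂ Bv = record
      { region = B
      ; member = Bv
      ; within = λ w → ∨-true⁺ʳ {U w}
      ; linked = CoreLinked.boundary-linked em G locally-finite connected r S K
                   λ R R′ p q → end-injective {R} {R′} (≡.trans (end-cong {R} {S} p) (sym (end-cong {R′} {S} q)))
      ; conn   = Core.connected K
      ; sealed = λ e cr → let u , w , J , Bu , Bw = crossing-ends B cr in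
          cross-true (U ∪ B) J (∨-true⁺ʳ {U u} Bu) (cong₂ _∨_ (¬true λ Uw → B-sealed (joins-sym J) Bu Uw) Bw)
      }

  -- One ray represents its whole end. The number `n` may also belong to no end, or to one already
  -- captured; then nothing is added.
  extend : ∀ (Q : Packing) n →
    Σ[ Q′ ∈ Packing ] (Packing.U Q ⊑ Packing.U Q′ × (∀ R → end R ≡ n → Eventually R (Packing.U Q′)))
  extend Q n with em {Σ[ S ∈ Ray G ] (end S ≡ n × ¬ Eventually S (Packing.U Q))}
  ... | yes (S , refl , ¬ev) = add Q S ¬ev
  ... | no none = Q , (λ _ → id) , λ R eq → by-contradiction λ ¬ev → none (R , eq , ¬ev)

  packing : ℕ → Packing
  packing zero    = empty
  packing (suc n) = proj₁ (extend (packing n) n)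

  packed : ℕ → Region
  packed n = Packing.U (packing n)

  packed-mono : ∀ {m n} → m ≤ n → packed m ⊑ packed n
  packed-mono {m} {n} m≤n v Um = subst (λ k → packed k v ≡ true) (m∸n+n≡m m≤n) (grow (n ∸ m))
    where
    grow : ∀ k → packed (k + m) v ≡ true
    grow zero    = Um
    grow (suc k) = proj₁ (proj₂ (extend (packing (k + m)) (k + m))) v (grow k)

  captured : ∀ R → Eventually R (packed (suc (end R)))
  captured R = proj₂ (proj₂ (extend (packing (end R)) (end R))) R refl

  -- Kőnig's lemma along shortest paths from the root.

  data Descends : V → V → Set where
    self  : ∀ {u} → Descends u u
    child : ∀ {e u c v} → Joins G e u c → dist c ≡ suc (dist u) → Descends c v → Descends u v

  descends-snoc : ∀ {e u c v} → Descends u c → Joins G e c v → dist v ≡ suc (dist c) → Descends u v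
  descends-snoc self           J d = child J d self
  descends-snoc (child J′ d′ p) J d = child J′ d′ (descends-snoc p J d)

  root-descends : ∀ n v → dist v ≡ n → Descends r v
  root-descends zero v d with subst (λ k → v ∈ ball k) d (∈-ball-dist v)
  ... | here refl = self
  root-descends (suc n) v d with u , e , J , refl ← predecessor d =
    descends-snoc (root-descends n u refl) J d

  -- The quantifier over `n` is needed because the ray is built before it is known which packing
  -- captures its end.
  Heavy : V → Set
  Heavy u = ∀ n X → ∃[ v ] (Descends u v × v ∉ X × packed n v ≡ false)

  -- If no child were heavy, each of the finitely many neighbours would be light for some `n`.
  -- Packings only grow, so the largest of these `n` would serve for all, and `u` would not be
  -- heavy.
  heavy-child : ∀ {u} → Heavy u → ∃[ c ] ∃[ e ] (Joins G e u c × dist c ≡ suc (dist u) × Heavy c)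
  heavy-child {u} heavy = by-contradiction λ none →
    let n , X , light      = collect none (neighbours u)
        v , desc , v∉ , Uv = heavy n (u ∷ X)
    in impossible {n} {X} light desc v∉ Uv
    where
    Light : ℕ → List V → V → Set
    Light n X c = ∀ {e v} → Joins G e u c → dist c ≡ suc (dist u) → Descends c v → packed n v ≡ false → v ∈ X

    impossible : ∀ {n X} → (∀ {c} → c ∈ neighbours u → Light n X c) →
                 ∀ {v} → Descends u v → v ∉ u ∷ X → packed n v ≡ false → ⊥
    impossible light self           v∉ Uv = v∉ (here refl)
    impossible light (child J d desc) v∉ Uv =
      v∉ (there (light (∈-ends (joins-incident (joins-sym J)) (∈-incident (joins-incident J))) J d desc Uv))

    weaken : ∀ {m n X Y c} → m ≤ n → X ⊆ Y → Light m X c → Light n Y c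
    weaken m≤n X⊆Y light J d desc Uv = X⊆Y (light J d desc (¬true λ Um → true≢false (packed-mono m≤n _ Um) Uv))

    single : ¬ (∃[ c ] ∃[ e ] (Joins G e u c × dist c ≡ suc (dist u) × Heavy c)) →
             ∀ c → ∃[ n ] ∃[ X ] Light n X c
    single none c = by-contradiction λ ¬light →
      let e , v , J , d , desc , Uv , v∉ = counterexample ¬light 0 []
      in none (c , e , J , d , λ n X →
           let _ , v , _ , _ , desc , Uv , v∉ = counterexample ¬light n X in v , desc , v∉ , Uv)
      where
      counterexample : ¬ (∃[ n ] ∃[ X ] Light n X c) → ∀ n X →
        ∃[ e ] ∃[ v ] (Joins G e u c × dist c ≡ suc (dist u) × Descends c v × packed n v ≡ false × v ∉ X)
      counterexample ¬light n X = by-contradiction λ ¬ex → ¬light (n , X , λ J d desc Uv →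
        by-contradiction λ v∉ → ¬ex (_ , _ , J , d , desc , Uv , v∉))

    collect : ¬ (∃[ c ] ∃[ e ] (Joins G e u c × dist c ≡ suc (dist u) × Heavy c)) →
              ∀ Y → ∃[ n ] ∃[ X ] (∀ {c} → c ∈ Y → Light n X c)
    collect none []      = 0 , [] , λ ()
    collect none (c ∷ Y) with m , X , light ← single none c | n , X′ , lights ← collect none Y =
      m ⊔ n , X ++ X′ , λ where
        (here refl) → weaken (m≤m⊔n m n) ∈-++⁺ˡ light
        (there c∈)  → weaken (m≤n⊔m m n) (∈-++⁺ʳ X) (lights c∈)

  -- Kőnig's lemma: otherwise heavy vertices form a ray of increasing distance
  -- from r.  Its tail lies in some packed m, and far out no edge leaves packed m.
  cofinite : ∃[ n ] ∃[ X ] (∀ v → packed n v ≡ false → v ∈ X)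
  cofinite = by-contradiction λ none → contradictory λ n X → by-contradiction λ ¬ex →
    none (n , X , λ v Uv → by-contradiction λ v∉ → ¬ex (v , root-descends _ v refl , v∉ , Uv))
    where
    contradictory : ¬ Heavy r
    contradictory heavy-r = true≢false
      (stays desc (inU K (m≤m⊔n N n₀)) (≤-trans (m≤n⊔m N n₀) (≤-reflexive (sym (dist-at K))))) Uv
      where
      at : ℕ → Σ V Heavy
      at zero    = r , heavy-r
      at (suc n) = let c , _ , _ , _ , h = heavy-child (proj₂ (at n)) in c , h

      dist-at : ∀ n → dist (proj₁ (at n)) ≡ n
      dist-at zero    = n≤0⇒n≡0 (dist-≤ (here refl))
      dist-at (suc n) = let _ , _ , _ , d , _ = heavy-child (proj₂ (at n)) in ≡.trans d (cong suc (dist-at n))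

      R : Ray G
      R = record
        { vertex    = proj₁ ∘ at
        ; edge      = λ n → proj₁ (proj₂ (heavy-child (proj₂ (at n))))
        ; joins     = λ n → proj₁ (proj₂ (proj₂ (heavy-child (proj₂ (at n)))))
        ; injective = λ {m} {n} eq → ≡.trans (sym (dist-at m)) (≡.trans (cong dist eq) (dist-at n))
        }

      m : ℕ
      m = suc (end R)

      N : ℕ
      N = proj₁ (captured R)

      inU : ∀ n → N ≤ n → packed m (vertex R n) ≡ true
      inU = proj₂ (captured R)

      n₀ : ℕ
      n₀ = proj₁ (dist-bound (ends (Packing.border (packing m))))

      near : ∀ {v} → v ∈ ends (Packing.border (packing m)) → dist v < n₀
      near = proj₂ (dist-bound (ends (Packing.border (packing m))))

      K : ℕ
      K = N ⊔ n₀

      found : ∃[ v ] (Descends (vertex R K) v × v ∉ [] × packed m v ≡ false)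
      found = proj₂ (at K) m []

      desc = proj₁ (proj₂ found)
      Uv   = proj₂ (proj₂ (proj₂ found))

      stays : ∀ {u v} → Descends u v → packed m u ≡ true → n₀ ≤ dist u → packed m v ≡ true
      stays self           Uu _  = Uu
      stays (child J d p) Uu le = stays p
        (≡.trans (sym (uncrossed (packed m) J λ cr →
          <⇒≱ (near (∈-ends (joins-incident J) (Packing.covers (packing m) _ cr))) le)) Uu)
        (≤-trans (m≤n⇒m≤1+n le) (≤-reflexive (sym d)))

  component-linked : ∀ (Q : Packing) A →
                     (∀ {v} → v ∉ A → Packing.U Q v ≡ true) → (∀ {v} → Packing.U Q v ≡ true → v ∉ A) →
                     ∀ B → IsComponentOutside G A B → BoundaryLinked G B
  component-linked Q A ∉A⇒U U⇒∉A B component with IsComponentOutside.nonempty component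
  ... | v , Bv = transfer (Piece.linked P)
    where
    open Packing Q
    open IsComponentOutside component using (maximal) renaming (avoids to B-avoids; connected to B-connected)

    B⇒U : ∀ {w} → B w → U w ≡ true
    B⇒U Bw = ∉A⇒U (B-avoids _ Bw)

    P : Piece U v
    P = piece v (B⇒U Bv)

    C : Region
    C = Piece.region P

    -- A path inside the component stays in `U`, so by `sealed` it cannot leave the piece.
    B⇒C : ∀ {w} → B w → C w ≡ true
    B⇒C {w} Bw with Q , refl , refl , inB ← B-connected v w Bv Bw =
      <-weakInduction (λ i → C (Path.vertex Q i) ≡ true) (Piece.member P)
        (λ i Ci → ≡.trans (sym (uncrossed C (Path.joins Q i) λ cr →
          true≢false (Piece.sealed P _ cr)
            (cross-false U (Path.joins Q i) (≡.trans (B⇒U (inB _)) (sym (B⇒U (inB _))))))) Ci)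
        (fromℕ _)

    C⇒B : ∀ {w} → C w ≡ true → B w
    C⇒B = maximal ⟨ C ⟩ (λ w Cw → U⇒∉A (Piece.within P w Cw)) (Piece.conn P) B⇒C

    transfer : BoundaryLinked G ⟨ C ⟩ → BoundaryLinked G B
    transfer (I , R , edges , disjoint , related , first) =
      I , R , (λ i n → map₁₂ (edges i n)) , disjoint , related , λ e → first e ∘ boundary
      where
      map₁₂ : ∀ {e} → Inside G ⟨ C ⟩ e ⊎ Boundary G ⟨ C ⟩ e → Inside G B e ⊎ Boundary G B e
      map₁₂ (inj₁ (p , q))        = inj₁ (C⇒B p , C⇒B q)
      map₁₂ (inj₂ (inj₁ (p , q))) = inj₂ (inj₁ (C⇒B p , q ∘ B⇒C))
      map₁₂ (inj₂ (inj₂ (p , q))) = inj₂ (inj₂ (p ∘ B⇒C , C⇒B q))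

      boundary : ∀ {e} → Boundary G B e → Boundary G ⟨ C ⟩ e
      boundary (inj₁ (p , q)) = inj₁ (B⇒C p , q ∘ C⇒B)
      boundary (inj₂ (p , q)) = inj₂ (p ∘ C⇒B , B⇒C q)

  separator : Σ[ A ∈ List V ] (A′ ⊆ A × (∀ B → IsComponentOutside G A B → BoundaryLinked G B))
  separator with n , X , small ← cofinite =
    A , A′⊆A , component-linked (packing n) A
      (λ v∉ → by-contradiction λ ¬U → v∉ (∈A (¬true ¬U)))
      (λ Uv v∈ → true≢false Uv (not-injective (proj₂ (∈-select⁻ (not ∘ packed n) X v∈))))
    where
    -- The list `X` may contain packed vertices; they are removed so that `A` is exactly the
    -- complement of `packed n`.
    A : List V
    A = select (not ∘ packed n) X

    ∈A : ∀ {v} → packed n v ≡ false → v ∈ A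
    ∈A {v} Uv = ∈-select⁺ (not ∘ packed n) (small v Uv) (cong not Uv)

    A′⊆A : A′ ⊆ A
    A′⊆A v∈ = ∈A (¬true λ Uv → Packing.avoids (packing n) Uv v∈)

theorem2p2 : (∀ ℓ → ExcludedMiddle ℓ) →
    (G : Graph) → LocallyFinite G → Connected G → CountablyManyEnds G →
    (A′ : List (Graph.V G)) →
    Σ[ A ∈ List (Graph.V G) ]
      (A′ ⊆ A ×
       ((B : Pred (Graph.V G) 0ℓ) → IsComponentOutside G A B → BoundaryLinked G B))
theorem2p2 lem G locally-finite connected ends-countable A′ with lem 0ℓ {Graph.V G}
... | yes r    = Packings.separator (lem 0ℓ) G locally-finite connected r ends-countable A′
-- Only a graph without vertices offers no root for the distances, and it has no components.
... | no empty = A′ , id , λ B component → ⊥-elim (empty (proj₁ (IsComponentOutside.nonempty component)))
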